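{- There exist absolute constants $\epsilon_0>0$ and $C>0$ such that for every $0<\epsilon<\epsilon_0$ and every positive integer $n$, every graph on $n$ vertices with at least $n^2/4$ edges and book number at most $\left(\frac16+\epsilon^3\right)n$ which is not the balanced complete bipartite graph has at least $\left(\frac{1}{108}-C\epsilon\right)n^3$ triangles.
   Context: The book number of a graph $G$ is the maximum, over all edges $uv$ of $G$, of the number of triangles containing $uv$ (equivalently, the number of common neighbours of $u$ and $v$). The balanced complete bipartite graph on $n$ vertices is the complete bipartite graph with parts of sizes $\lfloor n/2\rfloor$ and $\lceil n/2\rceil$. -}

module Defs where

open import Data.Nat using (ℕ; zero; suc; _+_; _*_; _<ᵇ_; _⊔_; _/_)
open import Data.Fin using (Fin; toℕ)
open import Data.Bool using (Bool; true; false; if_then_else_; _∧_; _xor_)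
open import Relation.Binary.PropositionalEquality using (_≡_)
open import Function.Bundles using (_↔_; Inverse)
open import Data.Product using (Σ)

record Graph (n : ℕ) : Set where
  field
    adj   : Fin n → Fin n → Bool
    sym   : ∀ u v → adj u v ≡ adj v u
    irrefl : ∀ v → adj v v ≡ false
open Graph public

∑ : (n : ℕ) → (Fin n → ℕ) → ℕ
∑ zero    f = 0
∑ (suc n) f = f Fin.zero + ∑ n (λ i → f (Fin.suc i))

maxOver : (n : ℕ) → (Fin n → ℕ) → ℕ
maxOver zero    f = 0
maxOver (suc n) f = f Fin.zero ⊔ maxOver n (λ i → f (Fin.suc i))

indicator : Bool → ℕ
indicator b = if b then 1 else 0

_<ᶠ_ : ∀ {n} → Fin n → Fin n → Bool
i <ᶠ j = toℕ i <ᵇ toℕ j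

edgeCount : ∀ {n} → Graph n → ℕ
edgeCount {n} G = ∑ n λ u → ∑ n λ v → indicator ((u <ᶠ v) ∧ adj G u v)

triangleCount : ∀ {n} → Graph n → ℕ
triangleCount {n} G =
  ∑ n λ u → ∑ n λ v → ∑ n λ w →
    indicator ((u <ᶠ v) ∧ (v <ᶠ w) ∧ adj G u v ∧ adj G v w ∧ adj G u w)

codegree : ∀ {n} → Graph n → Fin n → Fin n → ℕ
codegree {n} G u v = ∑ n λ w → indicator (adj G u w ∧ adj G v w)

-- book number: maximum over edges uv of the number of common neighbours
-- (0 for the edgeless graph)
bookNumber : ∀ {n} → Graph n → ℕ
bookNumber {n} G =
  maxOver n λ u → maxOver n λ v → if adj G u v then codegree G u v else 0

balancedAdj : (n : ℕ) → Fin n → Fin n → Bool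
balancedAdj n i j = (toℕ i <ᵇ n / 2) xor (toℕ j <ᵇ n / 2)

IsBalancedCompleteBipartite : ∀ {n} → Graph n → Set
IsBalancedCompleteBipartite {n} G =
  Σ (Fin n ↔ Fin n) λ σ →
    ∀ i j → adj G (Inverse.to σ i) (Inverse.to σ j) ≡ balancedAdj n i j

{-# OPTIONS --safe #-}

-- Weight ordered pairs by a = 1 on edges and 0 elsewhere, and let b be the book number, d the
-- degree, c the codegree, r(x,y) the number of common non-neighbours, ℓ(x) = ∑_y a(x,y) c(x,y)
-- twice the number of triangles at x, and τ = ∑_x ℓ(x) six times the number of triangles.
-- Counting, for every triangle, how the other vertices are joined to it gives
--   (6b - n) τ = 3 ∑ a c (b - c) + 3 ∑ a (b - c) r + 3b ∑ a (d(x) + d(y) - n) + 2 M,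
-- where M counts vertices joined to none or all of the corners of a triangle. For at least
-- n²/4 edges all terms on the right are nonnegative, so if 6b - n is small compared with n
-- then all of them are small compared with n τ. From this,
--  * within the link of x: ℓ(x) (2b² - ℓ(x)) is small, so ℓ(x) is near 0 or at least about 2b²;
--  * splitting the vertices along N(v): τ is at most a constant times n ℓ(v), up to small
--    errors, so ℓ(v) is not near 0 for typical v.
-- Hence τ is at least about 2b²n ≥ n³/18; the error is linear in 6b - n, hence in ε³. If τ = 0,
-- every term vanishes, which forces a balanced complete bipartite graph.

module Submission where

open import Defs
open import Data.Bool using (Bool; true; false; not; _∧_; _xor_; if_then_else_)
import Data.Bool.Properties as Bool
open import Data.Fin using (Fin; toℕ; fromℕ; punchOut)
open import Data.Fin.Permutation using (Permutation′; lift₀; insert; _⟨$⟩ʳ_)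
import Data.Fin.Permutation as Perm
open import Data.Fin.Properties using (toℕ-injective; any?; toℕ-fromℕ; _≟_)
open import Data.Integer using (ℤ; +_; 0ℤ)
import Data.Integer as ℤ
import Data.Integer.Properties as ℤ
open import Data.Nat using (ℕ; zero; suc)
open import Data.Nat as ℕ using ()
open import Data.Nat.DivMod using (m*n/n≡m)
import Data.Nat.Properties as ℕ
open import Data.Product using (Σ; _×_; _,_; proj₁; proj₂; ∃)
open import Data.Sum using (_⊎_; inj₁; inj₂)
open import Relation.Binary.PropositionalEquality as ≡ using (_≡_; _≢_; refl; cong; cong₂; subst)
open import Relation.Nullary using (¬_; yes; no; contradiction)
open import Relation.Nullary.Decidable using (toWitness)
open import Relation.Nullary.Reflects using (ofʸ; ofⁿ)

-- Finite integer sums and certificates of nonnegativity.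

module IntegerSums where
  open import Data.Integer public
    using (ℤ; +_; -[1+_]; +≤+; +<+; 0ℤ; 1ℤ; _+_; _*_; _-_; -_; _≤_; _<_)
  open import Data.Integer.Properties public using (<⇒≤)
  import Algebra.Properties.Semiring.Sum ℤ.+-*-semiring as Vec
  open import Data.Integer.Tactic.RingSolver public using (solve-∀)

  infixl 6 _⊞_ _⊕_
  infixl 7 _⊠_
  infixr 7 _⊙_

  0≤+ : ∀ {k} → 0ℤ ≤ + k
  0≤+ = +≤+ ℕ.z≤n

  _⊞_ : ∀ {i j} → 0ℤ ≤ i → 0ℤ ≤ j → 0ℤ ≤ i + j
  _⊞_ = ℤ.+-mono-≤

  _⊠_ : ∀ {i j} → 0ℤ ≤ i → 0ℤ ≤ j → 0ℤ ≤ i * j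
  _⊠_ {+ i} {j} _ 0≤j = subst (_≤ + i * j) (ℤ.*-zeroʳ (+ i)) (ℤ.*-monoˡ-≤-nonNeg (+ i) 0≤j)

  0≤square : ∀ i → 0ℤ ≤ i * i
  0≤square (+ i)    = 0≤+ {i} ⊠ 0≤+ {i}
  0≤square -[1+ i ] = +≤+ ℕ.z≤n

  -- Inequalities below are proved by certificates: a ring identity rewrites the quantity as a
  -- combination of sums and products already known to be nonnegative.
  nonneg-by : ∀ {i j} → i ≡ j → 0ℤ ≤ j → 0ℤ ≤ i
  nonneg-by i≡j = subst (0ℤ ≤_) (≡.sym i≡j)

  cancel-nonneg : ∀ {i j} → 0ℤ < i → 0ℤ ≤ i * j → 0ℤ ≤ j
  cancel-nonneg {+ zero} (+<+ ())
  cancel-nonneg {+ suc i} {j} 0<i 0≤ij =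
    ℤ.*-cancelˡ-≤-pos 0ℤ j (+ suc i) (subst (_≤ + suc i * j) (≡.sym (ℤ.*-zeroʳ (+ suc i))) 0≤ij)

  by-sign : ∀ {P : Set} i → (0ℤ ≤ i → P) → (0ℤ < - i → P) → P
  by-sign (+ i)    nonneg neg = nonneg 0≤+
  by-sign -[1+ i ] nonneg neg = neg (+<+ (ℕ.s≤s ℕ.z≤n))

  -- Abstract, so that unification treats ∑ᶻ as injective instead of unfolding it to a fold.
  -- A proof built from _⊕_ and _⊙_ mirrors the shape of the summand, which is why differences
  -- under a sum are written f i + (- 1ℤ) * g i below.
  abstract
    ∑ᶻ : ∀ {n} → (Fin n → ℤ) → ℤ
    ∑ᶻ = Vec.sum

    ∑ᶻ-zero : ∀ (f : Fin 0 → ℤ) → ∑ᶻ f ≡ 0ℤ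
    ∑ᶻ-zero f = refl

    ∑ᶻ-suc : ∀ {n} (f : Fin (suc n) → ℤ) → ∑ᶻ f ≡ f Fin.zero + ∑ᶻ (λ i → f (Fin.suc i))
    ∑ᶻ-suc f = refl

    ∑ᶻ-cong : ∀ {n} {f g : Fin n → ℤ} → (∀ i → f i ≡ g i) → ∑ᶻ f ≡ ∑ᶻ g
    ∑ᶻ-cong = Vec.sum-cong-≗

    ∑ᶻ-comm : ∀ {m n} (f : Fin m → Fin n → ℤ) → ∑ᶻ (λ i → ∑ᶻ (f i)) ≡ ∑ᶻ λ j → ∑ᶻ λ i → f i j
    ∑ᶻ-comm = Vec.∑-comm

    _⊕_ : ∀ {n} {f g : Fin n → ℤ} {s t} → ∑ᶻ f ≡ s → ∑ᶻ g ≡ t → ∑ᶻ (λ i → f i + g i) ≡ s + t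
    _⊕_ {f = f} {g} p q = ≡.trans (Vec.∑-distrib-+ f g) (cong₂ _+_ p q)

    _⊙_ : ∀ {n} {f : Fin n → ℤ} {s} k → ∑ᶻ f ≡ s → ∑ᶻ (λ i → k * f i) ≡ k * s
    _⊙_ {f = f} k p = ≡.trans (≡.sym (Vec.*-distribˡ-sum k f)) (cong (k *_) p)

  ∑ᶻ-const : ∀ n k → ∑ᶻ {n} (λ _ → k) ≡ k * + n
  ∑ᶻ-const zero    k = ≡.trans (∑ᶻ-zero _) (≡.sym (ℤ.*-zeroʳ k))
  ∑ᶻ-const (suc n) k = ≡.trans (∑ᶻ-suc _) (≡.trans (cong (λ s → k + s) (∑ᶻ-const n k)) (step k (+ n)))
    where
    step : ∀ k m → k + k * m ≡ k * (1ℤ + m)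
    step = solve-∀

  ∑ᶻ-nonneg : ∀ {n} {f : Fin n → ℤ} → (∀ i → 0ℤ ≤ f i) → 0ℤ ≤ ∑ᶻ f
  ∑ᶻ-nonneg {zero}  {f} 0≤f = nonneg-by (∑ᶻ-zero f) 0≤+
  ∑ᶻ-nonneg {suc n} {f} 0≤f = nonneg-by (∑ᶻ-suc f) (0≤f Fin.zero ⊞ ∑ᶻ-nonneg (λ i → 0≤f (Fin.suc i)))

  ∑³ : ∀ {n} → (Fin n → Fin n → Fin n → ℤ) → ℤ
  ∑³ f = ∑ᶻ λ x → ∑ᶻ λ y → ∑ᶻ λ z → f x y z

  ∑³-cong : ∀ {n} {f g : Fin n → Fin n → Fin n → ℤ} → (∀ x y z → f x y z ≡ g x y z) → ∑³ f ≡ ∑³ g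
  ∑³-cong f≡g = ∑ᶻ-cong λ x → ∑ᶻ-cong λ y → ∑ᶻ-cong λ z → f≡g x y z

  ∑³-⊕ : ∀ {n} {f g : Fin n → Fin n → Fin n → ℤ} {s t} →
         ∑³ f ≡ s → ∑³ g ≡ t → ∑³ (λ x y z → f x y z + g x y z) ≡ s + t
  ∑³-⊕ p q = ≡.trans (∑ᶻ-cong λ x → ≡.trans (∑ᶻ-cong λ y → refl ⊕ refl) (refl ⊕ refl)) (p ⊕ q)

  ∑³-⊙ : ∀ {n} {f : Fin n → Fin n → Fin n → ℤ} {s} k → ∑³ f ≡ s → ∑³ (λ x y z → k * f x y z) ≡ k * s
  ∑³-⊙ k p = ≡.trans (∑ᶻ-cong λ x → ≡.trans (∑ᶻ-cong λ y → k ⊙ refl) (k ⊙ refl)) (k ⊙ p)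

  ∑³-rotate : ∀ {n} (f : Fin n → Fin n → Fin n → ℤ) → ∑³ (λ x y z → f y z x) ≡ ∑³ f
  ∑³-rotate f = ≡.trans (∑ᶻ-comm λ x y → ∑ᶻ λ z → f y z x) (∑ᶻ-cong λ y → ∑ᶻ-comm λ x z → f y z x)

  -- Serves to symmetrise a summand attached to one pair of corners over all three pairs of a
  -- triangle.
  ∑³-cyclic : ∀ {n} (f : Fin n → Fin n → Fin n → ℤ) →
              ∑³ (λ x y z → f x y z + f y z x + f z x y) ≡ + 3 * ∑³ f
  ∑³-cyclic f = ≡.trans
    (∑³-⊕ (∑³-⊕ refl (∑³-rotate f)) (≡.trans (∑³-rotate λ x y z → f y z x) (∑³-rotate f)))
    (triple (∑³ f))
    where
    triple : ∀ s → s + s + s ≡ + 3 * s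
    triple = solve-∀

  ≤-via : ∀ {i j k s} → s ≡ j + k → 0ℤ ≤ j → i ≤ k → i ≤ s
  ≤-via {i} {j} {k} refl 0≤j i≤k = subst (_≤ j + k) (ℤ.+-identityˡ i) (ℤ.+-mono-≤ 0≤j i≤k)

  term≤∑ᶻ : ∀ {n} {f : Fin n → ℤ} → (∀ i → 0ℤ ≤ f i) → ∀ i → f i ≤ ∑ᶻ f
  term≤∑ᶻ {f = f} 0≤f Fin.zero = ≤-via (≡.trans (∑ᶻ-suc f) (ℤ.+-comm (f Fin.zero) _))
    (∑ᶻ-nonneg λ i → 0≤f (Fin.suc i)) ℤ.≤-refl
  term≤∑ᶻ {f = f} 0≤f (Fin.suc i) = ≤-via (∑ᶻ-suc f)
    (0≤f Fin.zero) (term≤∑ᶻ (λ i → 0≤f (Fin.suc i)) i)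

  ∑ᶻ≡0 : ∀ {n} {f : Fin n → ℤ} → (∀ i → 0ℤ ≤ f i) → ∑ᶻ f ≤ 0ℤ → ∀ i → f i ≡ 0ℤ
  ∑ᶻ≡0 0≤f ∑≤0 i = ℤ.≤-antisym (ℤ.≤-trans (term≤∑ᶻ 0≤f i) ∑≤0) (0≤f i)

  square≡0 : ∀ i → i * i ≡ 0ℤ → i ≡ 0ℤ
  square≡0 i i²≡0 with ℤ.i*j≡0⇒i≡0∨j≡0 i i²≡0
  ... | inj₁ i≡0 = i≡0
  ... | inj₂ i≡0 = i≡0

-- Degrees, codegrees and triangle sums of a weighted graph.

module Weights where
  open IntegerSums

  module WeightedGraph {n : ℕ} (a : Fin n → Fin n → ℤ)
    (a-sym : ∀ x y → a x y ≡ a y x) (0≤a : ∀ x y → 0ℤ ≤ a x y) (0≤1-a : ∀ x y → 0ℤ ≤ 1ℤ - a x y)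
    where

    N : ℤ
    N = + n

    d : Fin n → ℤ
    d x = ∑ᶻ (a x)

    c r : Fin n → Fin n → ℤ
    c x y = ∑ᶻ λ w → a x w * a y w
    r x y = ∑ᶻ λ w → (1ℤ - a x w) * (1ℤ - a y w)

    ℓ : Fin n → ℤ
    ℓ x = ∑ᶻ λ y → a x y * c x y

    T k m : Fin n → Fin n → Fin n → ℤ
    T x y z = a x y * (a x z * a y z)
    k x y z = ∑ᶻ λ w → a x w * (a y w * a z w)
    m x y z = ∑ᶻ λ w → (1ℤ - a x w) * ((1ℤ - a y w) * (1ℤ - a z w)) + a x w * (a y w * a z w)

    -- For a graph, `K x` is six times the number of complete subgraphs on four vertices through
    -- `x`.
    S K : Fin n → ℤ
    S x = ∑ᶻ λ y → a x y * (d x + d y - N)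
    K x = ∑ᶻ λ y → ∑ᶻ λ z → T x y z * k x y z

    τ ΣS ΣM V : ℤ
    τ  = ∑ᶻ ℓ
    ΣS = ∑ᶻ S
    ΣM = ∑³ λ x y z → T x y z * m x y z
    V  = ∑ᶻ λ x → (+ 2 * d x - N) * (+ 2 * d x - N)

    T-rotate : ∀ x y z → T y z x ≡ T x y z
    T-rotate x y z rewrite a-sym y x | a-sym z x = eq (a x y) (a x z) (a y z)
      where
      eq : ∀ p q r → r * (p * q) ≡ p * (q * r)
      eq = solve-∀

    T-swap : ∀ x y z → T x z y ≡ T x y z
    T-swap x y z rewrite a-sym z y = eq (a x y) (a x z) (a y z)
      where
      eq : ∀ p q r → q * (p * r) ≡ p * (q * r)
      eq = solve-∀

    0≤T : ∀ x y z → 0ℤ ≤ T x y z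
    0≤T x y z = 0≤a x y ⊠ (0≤a x z ⊠ 0≤a y z)

    T-sum : ∀ x y → ∑ᶻ (T x y) ≡ a x y * c x y
    T-sum x y = a x y ⊙ refl

    ∑T-first : ∀ x (f : Fin n → ℤ) → ∑ᶻ (λ y → ∑ᶻ λ z → T x y z * f y) ≡ ∑ᶻ λ y → a x y * c x y * f y
    ∑T-first x f = ∑ᶻ-cong λ y → ≡.trans
      (∑ᶻ-cong λ z → ℤ.*-comm (T x y z) (f y))
      (≡.trans (f y ⊙ T-sum x y) (ℤ.*-comm (f y) (a x y * c x y)))

    ∑T-second : ∀ x (f : Fin n → ℤ) → ∑ᶻ (λ y → ∑ᶻ λ z → T x y z * f z) ≡ ∑ᶻ λ y → a x y * c x y * f y
    ∑T-second x f = ≡.trans (∑ᶻ-comm λ y z → T x y z * f z)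
      (≡.trans (∑ᶻ-cong λ z → ∑ᶻ-cong λ y → cong (_* f z) (≡.sym (T-swap x y z))) (∑T-first x f))

    ∑T-const : ∀ x q → ∑ᶻ (λ y → ∑ᶻ λ z → T x y z * q) ≡ q * ℓ x
    ∑T-const x q = ≡.trans (∑T-first x λ _ → q) (≡.trans (∑ᶻ-cong λ y → ℤ.*-comm (a x y * c x y) q) (q ⊙ refl))

    ∑³T : ∑³ T ≡ τ
    ∑³T = ∑ᶻ-cong λ x → ∑ᶻ-cong λ y → T-sum x y

    -- A vertex with p, q, s ∈ {0,1} joined to the three corners satisfies
    -- pq + qs + sp = p + q + s - 1 + (1-p)(1-q)(1-s) + pqs.
    corner-identity : ∀ x y z → c x y + c y z + c z x + N ≡ d x + d y + d z + m x y z
    corner-identity x y z = ≡.trans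
      (≡.sym (refl ⊕ refl ⊕ refl ⊕ ≡.trans (∑ᶻ-const n 1ℤ) (ℤ.*-identityˡ N)))
      (≡.trans (∑ᶻ-cong λ w → eq (a x w) (a y w) (a z w)) (refl ⊕ refl ⊕ refl ⊕ refl))
      where
      eq : ∀ p q s → p * q + q * s + s * p + 1ℤ
         ≡ p + q + s + ((1ℤ - p) * ((1ℤ - q) * (1ℤ - s)) + p * (q * s))
      eq = solve-∀

    r-identity : ∀ x y → r x y ≡ N - d x - d y + c x y
    r-identity x y = ≡.trans (∑ᶻ-cong λ w → expand (a x w) (a y w))
      (≡.trans (∑ᶻ-const n 1ℤ ⊕ (- 1ℤ) ⊙ refl ⊕ (- 1ℤ) ⊙ refl ⊕ refl) (eq N (d x) (d y) (c x y)))
      where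
      expand : ∀ p q → (1ℤ - p) * (1ℤ - q) ≡ 1ℤ + (- 1ℤ) * p + (- 1ℤ) * q + p * q
      expand = solve-∀
      eq : ∀ N p q s → 1ℤ * N + (- 1ℤ) * p + (- 1ℤ) * q + s ≡ N - p - q + s
      eq = solve-∀

    -- This is `corner-identity` summed over triangles: adding `2c - d - d` over the three sides of
    -- a triangle gives `2(m - N)`, and the factor 3 comes from the three rotations.
    edge-identity : + 3 * (∑ᶻ λ x → ∑ᶻ λ y → a x y * c x y * (+ 2 * c x y - d x - d y))
                  ≡ + 2 * ΣM + (- (+ 2 * N)) * τ
    edge-identity = ≡.trans
      (cong (+ 3 *_) (≡.sym (∑ᶻ-cong λ x → ∑T-first x λ y → + 2 * c x y - d x - d y)))
      (≡.trans (≡.sym (∑³-cyclic f))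
      (≡.trans (∑³-cong pointwise) (∑³-⊕ (∑³-⊙ (+ 2) refl) (∑³-⊙ (- (+ 2 * N)) ∑³T))))
      where
      f : Fin n → Fin n → Fin n → ℤ
      f x y z = T x y z * (+ 2 * c x y - d x - d y)
      eq : ∀ t N c₁ c₂ c₃ d₁ d₂ d₃ m → c₁ + c₂ + c₃ + N ≡ d₁ + d₂ + d₃ + m →
           t * (+ 2 * c₁ - d₁ - d₂) + t * (+ 2 * c₂ - d₂ - d₃) + t * (+ 2 * c₃ - d₃ - d₁)
           ≡ + 2 * (t * m) + (- (+ 2 * N)) * t
      eq t N c₁ c₂ c₃ d₁ d₂ d₃ m h =
        ≡.trans (lhs t N c₁ c₂ c₃ d₁ d₂ d₃)
          (≡.trans (cong (λ s → + 2 * (t * (s - (N + (d₁ + d₂ + d₃))))) h) (rhs t N (d₁ + d₂ + d₃) m))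
        where
        lhs : ∀ t N c₁ c₂ c₃ d₁ d₂ d₃ →
          t * (+ 2 * c₁ - d₁ - d₂) + t * (+ 2 * c₂ - d₂ - d₃) + t * (+ 2 * c₃ - d₃ - d₁)
          ≡ + 2 * (t * (c₁ + c₂ + c₃ + N - (N + (d₁ + d₂ + d₃))))
        lhs = solve-∀
        rhs : ∀ t N s m → + 2 * (t * (s + m - (N + s))) ≡ + 2 * (t * m) + (- (+ 2 * N)) * t
        rhs = solve-∀
      pointwise : ∀ x y z → f x y z + f y z x + f z x y ≡ + 2 * (T x y z * m x y z) + (- (+ 2 * N)) * T x y z
      pointwise x y z rewrite T-rotate x y z | T-rotate y z x | T-rotate x y z =
        eq (T x y z) N (c x y) (c y z) (c z x) (d x) (d y) (d z) (m x y z) (corner-identity x y z)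

    0≤c : ∀ x y → 0ℤ ≤ c x y
    0≤c x y = ∑ᶻ-nonneg λ w → 0≤a x w ⊠ 0≤a y w

    0≤r : ∀ x y → 0ℤ ≤ r x y
    0≤r x y = ∑ᶻ-nonneg λ w → 0≤1-a x w ⊠ 0≤1-a y w

    0≤k : ∀ x y z → 0ℤ ≤ k x y z
    0≤k x y z = ∑ᶻ-nonneg λ w → 0≤a x w ⊠ (0≤a y w ⊠ 0≤a z w)

    0≤m : ∀ x y z → 0ℤ ≤ m x y z
    0≤m x y z = ∑ᶻ-nonneg λ w →
      0≤1-a x w ⊠ (0≤1-a y w ⊠ 0≤1-a z w) ⊞ 0≤a x w ⊠ (0≤a y w ⊠ 0≤a z w)

    0≤ℓ : ∀ x → 0ℤ ≤ ℓ x
    0≤ℓ x = ∑ᶻ-nonneg λ y → 0≤a x y ⊠ 0≤c x y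

    0≤τ : 0ℤ ≤ τ
    0≤τ = ∑ᶻ-nonneg 0≤ℓ

    0≤ΣM : 0ℤ ≤ ΣM
    0≤ΣM = ∑ᶻ-nonneg λ x → ∑ᶻ-nonneg λ y → ∑ᶻ-nonneg λ z → 0≤T x y z ⊠ 0≤m x y z

    -- `m - k` counts the common non-neighbours of the three corners. The comparison lets `ΣM` pay
    -- for the term `K` that arises in the links.
    K≤M : 0ℤ ≤ ΣM - ∑ᶻ K
    K≤M = nonneg-by
      (≡.sym (≡.trans (∑³-⊕ refl (∑³-⊙ (- 1ℤ) refl)) (eq ΣM (∑ᶻ K))))
      (∑ᶻ-nonneg λ x → ∑ᶻ-nonneg λ y → ∑ᶻ-nonneg λ z →
        nonneg-by (factor (T x y z) (m x y z) (k x y z)) (0≤T x y z ⊠ 0≤m-k x y z))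
      where
      eq : ∀ p q → p + (- 1ℤ) * q ≡ p - q
      eq = solve-∀
      factor : ∀ t m k → t * m + (- 1ℤ) * (t * k) ≡ t * (m + (- 1ℤ) * k)
      factor = solve-∀
      cancel : ∀ p q → p + q + (- 1ℤ) * q ≡ p
      cancel = solve-∀
      0≤m-k : ∀ x y z → 0ℤ ≤ m x y z + (- 1ℤ) * k x y z
      0≤m-k x y z = nonneg-by (≡.sym (refl ⊕ (- 1ℤ) ⊙ refl)) (∑ᶻ-nonneg λ w →
        nonneg-by (cancel _ (a x w * (a y w * a z w))) (0≤1-a x w ⊠ (0≤1-a y w ⊠ 0≤1-a z w)))

    0≤V : 0ℤ ≤ V
    0≤V = ∑ᶻ-nonneg λ x → 0≤square (+ 2 * d x - N)

    -- Double counting gives `ΣS = 2 ∑ d² - N ∑ d`, so the difference equals `N (2 ∑ d - N²)`. Thus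
    -- `ΣS` pays for all deviations of degrees from `N/2`.
    degree-variance : 0ℤ ≤ ∑ᶻ d + ∑ᶻ d - N * N → 0ℤ ≤ + 2 * ΣS - V
    degree-variance dense = nonneg-by
      (≡.trans (cong₂ (λ s t → + 2 * s - t) S-sum square-sum) (eq D₂ (∑ᶻ d) N))
      (0≤+ {n} ⊠ dense)
      where
      D₂ : ℤ
      D₂ = ∑ᶻ λ x → d x * d x
      eq : ∀ q s N → + 2 * (q + q + (- N) * s) - (+ 4 * q + (- (+ 4 * N)) * s + N * N * N) ≡ N * (s + s - N * N)
      eq = solve-∀
      expand : ∀ a p q N → a * (p + q - N) ≡ p * a + q * a + (- N) * a
      expand = solve-∀
      S-sum : ΣS ≡ D₂ + D₂ + (- N) * ∑ᶻ d
      S-sum = ≡.trans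
        (∑ᶻ-cong λ x → ≡.trans (∑ᶻ-cong λ y → expand (a x y) (d x) (d y) N) (d x ⊙ refl ⊕ refl ⊕ (- N) ⊙ refl))
        (refl ⊕ ≡.trans (∑ᶻ-comm λ x y → d y * a x y)
                  (∑ᶻ-cong λ y → ≡.trans (∑ᶻ-cong λ x → cong (d y *_) (a-sym x y)) (d y ⊙ refl))
              ⊕ (- N) ⊙ refl)
      square : ∀ p N → (+ 2 * p - N) * (+ 2 * p - N) ≡ + 4 * (p * p) + (- (+ 4 * N)) * p + N * N
      square = solve-∀
      square-sum : V ≡ + 4 * D₂ + (- (+ 4 * N)) * ∑ᶻ d + N * N * N
      square-sum = ≡.trans (∑ᶻ-cong λ x → square (d x) N)
        ((+ 4) ⊙ refl ⊕ (- (+ 4 * N)) ⊙ refl ⊕ ∑ᶻ-const n (N * N))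

    0≤ΣS : 0ℤ ≤ ∑ᶻ d + ∑ᶻ d - N * N → 0ℤ ≤ ΣS
    0≤ΣS dense = cancel-nonneg {+ 2} (+<+ (ℕ.s≤s ℕ.z≤n)) (nonneg-by (eq (+ 2 * ΣS) V)
      (degree-variance dense ⊞ 0≤V))
      where
      eq : ∀ p q → p ≡ p - q + q
      eq = solve-∀

    -- The relation with 0/1 indicator L need not be transitive: a cyclic orientation of a
    -- triangle only adds to the right-hand side.
    module Orientation (L : Fin n → Fin n → ℤ) (0≤L : ∀ x y → 0ℤ ≤ L x y) (0≤1-L : ∀ x y → 0ℤ ≤ 1ℤ - L x y)
      (L-total : ∀ x y → a x y ≡ 0ℤ ⊎ L y x ≡ 1ℤ - L x y) where

      H : Fin n → Fin n → Fin n → ℤ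
      H x y z = T x y z * (L x y * L y z)

      E : ℤ
      E = ∑ᶻ λ x → ∑ᶻ λ y → L x y * a x y

      2E≤∑d : 0ℤ ≤ ∑ᶻ d - (E + E)
      2E≤∑d = nonneg-by
        (≡.trans (eq (∑ᶻ d) E)
          (≡.sym (≡.trans (∑ᶻ-cong λ x → refl ⊕ (- 1ℤ) ⊙ refl ⊕ (- 1ℤ) ⊙ refl)
            (refl ⊕ (- 1ℤ) ⊙ refl ⊕ (- 1ℤ) ⊙ swapped))))
        (∑ᶻ-nonneg λ x → ∑ᶻ-nonneg λ y → pointwise x y)
        where
        swapped : ∑ᶻ (λ x → ∑ᶻ λ y → L y x * a x y) ≡ E
        swapped = ≡.trans (∑ᶻ-comm λ x y → L y x * a x y)
          (∑ᶻ-cong λ y → ∑ᶻ-cong λ x → cong (L y x *_) (a-sym x y))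
        eq : ∀ p q → p - (q + q) ≡ p + (- 1ℤ) * q + (- 1ℤ) * q
        eq = solve-∀
        zero-case : ∀ s t → 0ℤ + (- 1ℤ) * (s * 0ℤ) + (- 1ℤ) * (t * 0ℤ) ≡ 0ℤ
        zero-case = solve-∀
        total-case : ∀ a s → a + (- 1ℤ) * (s * a) + (- 1ℤ) * ((1ℤ - s) * a) ≡ 0ℤ
        total-case = solve-∀
        pointwise : ∀ x y → 0ℤ ≤ a x y + (- 1ℤ) * (L x y * a x y) + (- 1ℤ) * (L y x * a x y)
        pointwise x y with L-total x y
        ... | inj₁ e = nonneg-by (≡.trans (cong (λ s → s + (- 1ℤ) * (L x y * s) + (- 1ℤ) * (L y x * s)) e)
                                          (zero-case (L x y) (L y x))) 0≤+
        ... | inj₂ e = nonneg-by (≡.trans (cong (λ s → a x y + (- 1ℤ) * (L x y * a x y) + (- 1ℤ) * (s * a x y)) e)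
                                          (total-case (a x y) (L x y))) 0≤+

      τ≤6∑H : 0ℤ ≤ + 6 * ∑³ H - τ
      τ≤6∑H = nonneg-by
        (≡.trans (cong (λ t → + 6 * ∑³ H - t) (≡.sym ∑³T))
          (≡.trans (eq (∑³ H) (∑³ T))
            (≡.sym (∑³-⊕ (∑³-⊕ (∑³-cyclic H) (≡.trans (∑³-cyclic H′) (cong (+ 3 *_) H-swap))) (∑³-⊙ (- 1ℤ) refl)))))
        (∑ᶻ-nonneg λ x → ∑ᶻ-nonneg λ y → ∑ᶻ-nonneg λ z → pointwise x y z)
        where
        -- `H′` is `H` with the last two vertices exchanged; the rotations of both run through all
        -- six orderings of a triple.
        H′ : Fin n → Fin n → Fin n → ℤ
        H′ x y z = T x z y * (L x z * L z y)
        H-swap : ∑³ H′ ≡ ∑³ H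
        H-swap = ∑ᶻ-cong λ x → ∑ᶻ-comm λ y z → H x z y
        eq : ∀ p q → + 6 * p - q ≡ + 3 * p + + 3 * p + (- 1ℤ) * q
        eq = solve-∀
        sixfold : ℤ → (p p′ q q′ s s′ : ℤ) → ℤ
        sixfold t p p′ q q′ s s′ =
          t * (p * q) + t * (q * s) + t * (s * p) + (t * (s′ * q′) + t * (p′ * s′) + t * (q′ * p′)) + (- 1ℤ) * t
        as-sixfold : ∀ x y z →
          H x y z + H y z x + H z x y + (H′ x y z + H′ y z x + H′ z x y) + (- 1ℤ) * T x y z
          ≡ sixfold (T x y z) (L x y) (L y x) (L y z) (L z y) (L z x) (L x z)
        as-sixfold x y z
          rewrite T-swap x y z | T-swap y z x | T-swap z x y | T-rotate x y z | T-rotate y z x | T-rotate x y z = refl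
        vanish : ∀ t p p′ q q′ s s′ → t ≡ 0ℤ → 0ℤ ≤ sixfold t p p′ q q′ s s′
        vanish _ p p′ q q′ s s′ refl = nonneg-by (zeros p p′ q q′ s s′) 0≤+
          where
          zeros : ∀ p p′ q q′ s s′ → 0ℤ * (p * q) + 0ℤ * (q * s) + 0ℤ * (s * p)
            + (0ℤ * (s′ * q′) + 0ℤ * (p′ * s′) + 0ℤ * (q′ * p′)) + (- 1ℤ) * 0ℤ ≡ 0ℤ
          zeros = solve-∀
        complement : ∀ t p q s →
          t * (p * q) + t * (q * s) + t * (s * p) + (t * ((1ℤ - s) * (1ℤ - q)) + t * ((1ℤ - p) * (1ℤ - s))
            + t * ((1ℤ - q) * (1ℤ - p))) + (- 1ℤ) * t
          ≡ + 2 * t * (p * q * s + (1ℤ - p) * (1ℤ - q) * (1ℤ - s))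
        complement = solve-∀
        pointwise : ∀ x y z →
          0ℤ ≤ H x y z + H y z x + H z x y + (H′ x y z + H′ y z x + H′ z x y) + (- 1ℤ) * T x y z
        pointwise x y z = nonneg-by (as-sixfold x y z) (cases (L-total x y) (L-total y z) (L-total z x))
          where
          cases : a x y ≡ 0ℤ ⊎ L y x ≡ 1ℤ - L x y → a y z ≡ 0ℤ ⊎ L z y ≡ 1ℤ - L y z →
                  a z x ≡ 0ℤ ⊎ L x z ≡ 1ℤ - L z x →
                  0ℤ ≤ sixfold (T x y z) (L x y) (L y x) (L y z) (L z y) (L z x) (L x z)
          cases (inj₁ e) _ _ = vanish _ (L x y) (L y x) (L y z) (L z y) (L z x) (L x z)
            (cong (_* (a x z * a y z)) e)
          cases _ (inj₁ e) _ = vanish _ (L x y) (L y x) (L y z) (L z y) (L z x) (L x z)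
            (≡.trans (cong (λ s → a x y * (a x z * s)) e) (absorb (a x y) (a x z)))
            where
            absorb : ∀ p q → p * (q * 0ℤ) ≡ 0ℤ
            absorb = solve-∀
          cases _ _ (inj₁ e) = vanish _ (L x y) (L y x) (L y z) (L z y) (L z x) (L x z)
            (≡.trans (cong (λ s → a x y * (s * a y z)) (≡.trans (a-sym x z) e)) (absorb (a x y) (a y z)))
            where
            absorb : ∀ p q → p * (0ℤ * q) ≡ 0ℤ
            absorb = solve-∀
          cases (inj₂ e) (inj₂ f) (inj₂ g) rewrite e | f | g =
            nonneg-by (complement (T x y z) (L x y) (L y z) (L z x))
              (0≤+ {2} ⊠ 0≤T x y z ⊠ (0≤L x y ⊠ 0≤L y z ⊠ 0≤L z x ⊞ 0≤1-L x y ⊠ 0≤1-L y z ⊠ 0≤1-L z x))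

    -- Consequences of an upper bound `b` on the codegrees of edges.

    module BookBound (b : ℤ) (0≤b : 0ℤ ≤ b) (book : ∀ x y → 0ℤ ≤ a x y * (b - c x y)) where

      X W : Fin n → ℤ
      X x = ∑ᶻ λ y → a x y * c x y * (b - c x y)
      W x = ∑ᶻ λ y → a x y * (b - c x y) * r x y

      ΣX ΣW Δ : ℤ
      ΣX = ∑ᶻ X
      ΣW = ∑ᶻ W
      Δ  = + 6 * b - N

      -- Expanding `r` by `r-identity` gives a polynomial identity on each edge. Its remaining terms
      -- `3 a c (2c - d - d) + 2N a c` sum to `2 ΣM` by `edge-identity`.
      main-identity : Δ * τ ≡ + 3 * ΣX + + 3 * ΣW + + 3 * b * ΣS + + 2 * ΣM
      main-identity = ≡.trans
        (≡.sym (Δ ⊙ refl))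
        (≡.trans (∑ᶻ-cong λ x → ≡.trans (≡.sym (Δ ⊙ refl))
          (≡.trans (∑ᶻ-cong λ y → pointwise x y)
            (+ 3 ⊙ refl ⊕ + 3 ⊙ refl ⊕ (+ 3 * b) ⊙ refl ⊕ + 3 ⊙ refl ⊕ (+ 2 * N) ⊙ refl)))
        (≡.trans (+ 3 ⊙ refl ⊕ + 3 ⊙ refl ⊕ (+ 3 * b) ⊙ refl ⊕ ≡.trans (+ 3 ⊙ refl) edge-identity ⊕ (+ 2 * N) ⊙ refl)
                 (eq (+ 3 * ΣX + + 3 * ΣW + + 3 * b * ΣS) ΣM N τ)))
        where
        eq : ∀ s M N t → s + (+ 2 * M + (- (+ 2 * N)) * t) + + 2 * N * t ≡ s + + 2 * M
        eq = solve-∀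
        pointwise : ∀ x y → Δ * (a x y * c x y) ≡
          + 3 * (a x y * c x y * (b - c x y)) + + 3 * (a x y * (b - c x y) * r x y)
          + + 3 * b * (a x y * (d x + d y - N))
          + + 3 * (a x y * c x y * (+ 2 * c x y - d x - d y)) + + 2 * N * (a x y * c x y)
        pointwise x y rewrite r-identity x y = ring (a x y) b (c x y) (d x) (d y) N
          where
          ring : ∀ a b c d e N → (+ 6 * b - N) * (a * c) ≡
            + 3 * (a * c * (b - c)) + + 3 * (a * (b - c) * (N - d - e + c))
            + + 3 * b * (a * (d + e - N)) + + 3 * (a * c * (+ 2 * c - d - e)) + + 2 * N * (a * c)
          ring = solve-∀

      0≤X : ∀ x → 0ℤ ≤ X x
      0≤X x = ∑ᶻ-nonneg λ y → nonneg-by (eq (a x y) (c x y) (b - c x y)) (book x y ⊠ 0≤c x y)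
        where
        eq : ∀ p q r → p * q * r ≡ p * r * q
        eq = solve-∀

      0≤W : ∀ x → 0ℤ ≤ W x
      0≤W x = ∑ᶻ-nonneg λ y → book x y ⊠ 0≤r x y

      ℓ≤bN : ∀ x → 0ℤ ≤ b * N - ℓ x
      ℓ≤bN x = nonneg-by
        (≡.sym (≡.trans (∑ᶻ-const n b ⊕ (- 1ℤ) ⊙ refl) (eq (b * N) (ℓ x))))
        (∑ᶻ-nonneg λ y → nonneg-by (split (a x y) b (c x y)) (book x y ⊞ 0≤1-a x y ⊠ 0≤b))
        where
        eq : ∀ p q → p + (- 1ℤ) * q ≡ p - q
        eq = solve-∀
        split : ∀ a b c → b + (- 1ℤ) * (a * c) ≡ a * (b - c) + (1ℤ - a) * b
        split = solve-∀

      -- In the link of x every edge yz sees at least c(x,y) + c(x,z) - k(x,y,z) further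
      -- vertices, nearly all of full link degree b; hence ℓ(x) is close to 0 or at least 2b².
      link-dichotomy : ∀ x → 0ℤ ≤ b * (+ 4 * X x + K x) - ℓ x * (+ 2 * (b * b) - ℓ x)
      link-dichotomy x = nonneg-by
        (eq b (X x) (ℓ x) (K x) Q)
        (weighted ⊞ 0≤+ {2} ⊠ swapped)
        where
        -- The total shortfall from `b` of the link degrees of those `u` in the link of `x` that are
        -- adjacent to `y`; these degrees add up to `b * c x y - loss y`. Over the neighbours `y` of
        -- `x`, each `u` is charged `c x u` times, whence `loss-sum`.
        loss : Fin n → ℤ
        loss y = ∑ᶻ λ u → a y u * (a x u * (b - c x u))
        0≤loss : ∀ y → 0ℤ ≤ loss y
        0≤loss y = ∑ᶻ-nonneg λ u → 0≤a y u ⊠ book x u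
        Q : ℤ
        Q = ∑ᶻ λ y → a x y * c x y * (loss y - b * c x y)
        eq : ∀ b X l K Q → b * (+ 4 * X + K) - l * (+ 2 * (b * b) - l)
           ≡ (Q + Q + l * l + b * K) + + 2 * (b * X + (- (b * b)) * l + b * X + (- 1ℤ) * Q)
        eq = solve-∀
        loss-sum : ∑ᶻ (λ y → a x y * loss y) ≡ X x
        loss-sum = ≡.trans (∑ᶻ-cong λ y → ≡.sym (a x y ⊙ refl))
          (≡.trans (∑ᶻ-comm λ y u → a x y * (a y u * (a x u * (b - c x u))))
          (∑ᶻ-cong λ u → ≡.trans
            (∑ᶻ-cong λ y → ≡.trans (cong (λ s → a x y * (s * (a x u * (b - c x u)))) (a-sym y u))
                                   (reorder (a x y) (a u y) (a x u) (b - c x u)))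
            (≡.trans ((a x u * (b - c x u)) ⊙ refl) (reorder′ (a x u) (b - c x u) (c x u)))))
          where
          reorder : ∀ p q r s → p * (q * (r * s)) ≡ r * s * (p * q)
          reorder = solve-∀
          reorder′ : ∀ p q r → p * q * r ≡ p * r * q
          reorder′ = solve-∀
        -- Summing the nonnegative products `a (b - c) * loss` bounds `Q` above by `2b X - b² ℓ`;
        -- `weighted` bounds it below.
        swapped : 0ℤ ≤ b * X x + (- (b * b)) * ℓ x + b * X x + (- 1ℤ) * Q
        swapped = nonneg-by
          (≡.sym (b ⊙ loss-sum ⊕ (- (b * b)) ⊙ refl ⊕ b ⊙ refl ⊕ (- 1ℤ) ⊙ refl))
          (∑ᶻ-nonneg λ y → nonneg-by (eq′ b (a x y) (c x y) (loss y)) (book x y ⊠ 0≤loss y))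
          where
          eq′ : ∀ b a c l → b * (a * l) + (- (b * b)) * (a * c) + b * (a * c * (b - c))
              + (- 1ℤ) * (a * c * (l - b * c)) ≡ a * (b - c) * l
          eq′ = solve-∀
        -- Inclusion-exclusion: link degrees over the union of the neighbourhoods of `y` and `z` add
        -- up to at most `ℓ x`, and the overlap contributes at most `b` for each of its `k x y z`
        -- vertices.
        edge : ∀ y z → 0ℤ ≤ (loss y - b * c x y) + (loss z - b * c x z) + ℓ x + b * k x y z
        edge y z = nonneg-by
          (≡.trans (eq₁ (loss y) (loss z) b (c x y) (c x z) (ℓ x) (k x y z))
            (≡.sym (refl ⊕ refl ⊕ (- b) ⊙ refl ⊕ (- b) ⊙ refl ⊕ refl ⊕ b ⊙ refl)))
          (∑ᶻ-nonneg λ u → nonneg-by (eq₂ (a x u) (a y u) (a z u) b (c x u))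
            (0≤a x u ⊠ 0≤c x u ⊠ (0≤1-a y u ⊠ 0≤1-a z u) ⊞ 0≤a y u ⊠ 0≤a z u ⊠ book x u))
          where
          eq₁ : ∀ l m b c d q k → (l - b * c) + (m - b * d) + q + b * k
              ≡ l + m + (- b) * c + (- b) * d + q + b * k
          eq₁ = solve-∀
          eq₂ : ∀ e p q b c →
            p * (e * (b - c)) + q * (e * (b - c)) + (- b) * (e * p) + (- b) * (e * q) + e * c + b * (e * (p * q))
            ≡ e * c * ((1ℤ - p) * (1ℤ - q)) + p * q * (e * (b - c))
          eq₂ = solve-∀
        weighted : 0ℤ ≤ Q + Q + ℓ x * ℓ x + b * K x
        weighted = nonneg-by
          (≡.sym (≡.trans
            (∑ᶻ-cong λ y → ≡.trans (∑ᶻ-cong λ z → distrib (T x y z) _ _ (ℓ x) b (k x y z))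
              (refl ⊕ refl ⊕ refl ⊕ b ⊙ refl))
            (∑T-first x (λ y → loss y - b * c x y) ⊕ ∑T-second x (λ y → loss y - b * c x y)
              ⊕ ∑T-const x (ℓ x) ⊕ b ⊙ refl)))
          (∑ᶻ-nonneg λ y → ∑ᶻ-nonneg λ z → 0≤T x y z ⊠ edge y z)
          where
          distrib : ∀ t p q l b k → t * (p + q + l + b * k) ≡ t * p + t * q + t * l + b * (t * k)
          distrib = solve-∀

      -- The cut between a neighbourhood and its complement.

      module AroundVertex (v : Fin n) where

        -- `p` and `q` indicate the two sides of the cut, with `v` itself on the side of `q`. `g x`
        -- counts the vertices of N(v) missed by `x`, `Y` is twice the number of edges outside N(v),
        -- and `R` counts the missing pairs across the cut.
        p q g : Fin n → ℤ
        p x = a v x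
        q x = 1ℤ - a v x
        g x = ∑ᶻ λ u → p u * (1ℤ - a x u)

        Y R : ℤ
        Y = ∑ᶻ λ x → ∑ᶻ λ y → a x y * (q x * q y)
        R = ∑ᶻ λ x → q x * g x

        0≤g : ∀ x → 0ℤ ≤ g x
        0≤g x = ∑ᶻ-nonneg λ u → 0≤a v u ⊠ 0≤1-a x u

        -- Every triangle has two corners on the same side of the cut (N(v), V ∖ N(v)).
        triangles≤inner-edges : 0ℤ ≤ + 3 * (b * (ℓ v + Y)) - τ
        triangles≤inner-edges = nonneg-by
          (split (b * (ℓ v + Y)) A τ) (0≤+ {3} ⊠ edges ⊞ corners)
          where
          side : Fin n → Fin n → ℤ
          side x y = p x * p y + q x * q y
          0≤side : ∀ x y → 0ℤ ≤ side x y
          0≤side x y = 0≤a v x ⊠ 0≤a v y ⊞ 0≤1-a v x ⊠ 0≤1-a v y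
          A : ℤ
          A = ∑ᶻ λ x → ∑ᶻ λ y → a x y * c x y * side x y
          split : ∀ u a t → + 3 * u - t ≡ + 3 * (u - a) + (+ 3 * a - t)
          split = solve-∀
          inner-P : ∑ᶻ (λ x → ∑ᶻ λ y → a x y * (p x * p y)) ≡ ℓ v
          inner-P = ∑ᶻ-cong λ x → ≡.trans (∑ᶻ-cong λ y → reorder (a x y) (p x) (p y)) (p x ⊙ refl)
            where
            reorder : ∀ r s t → r * (s * t) ≡ s * (t * r)
            reorder = solve-∀
          inner : ∑ᶻ (λ x → ∑ᶻ λ y → a x y * side x y) ≡ ℓ v + Y
          inner = ≡.trans
            (∑ᶻ-cong λ x → ≡.trans (∑ᶻ-cong λ y → distrib (a x y) (p x * p y) (q x * q y)) (refl ⊕ refl))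
            (inner-P ⊕ refl)
            where
            distrib : ∀ r s t → r * (s + t) ≡ r * s + r * t
            distrib = solve-∀
          edges : 0ℤ ≤ b * (ℓ v + Y) - A
          edges = nonneg-by
            (≡.trans (eq (b * (ℓ v + Y)) A)
              (≡.sym (≡.trans (∑ᶻ-cong λ x → b ⊙ refl ⊕ (- 1ℤ) ⊙ refl) (b ⊙ inner ⊕ (- 1ℤ) ⊙ refl))))
            (∑ᶻ-nonneg λ x → ∑ᶻ-nonneg λ y →
              nonneg-by (factor (a x y) b (c x y) (side x y)) (book x y ⊠ 0≤side x y))
            where
            eq : ∀ p q → p - q ≡ p + (- 1ℤ) * q
            eq = solve-∀
            factor : ∀ a b c s → b * (a * s) + (- 1ℤ) * (a * c * s) ≡ a * (b - c) * s
            factor = solve-∀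
          corners : 0ℤ ≤ + 3 * A - τ
          corners = nonneg-by
            (≡.trans (cong₂ (λ s t → + 3 * s - t) (∑ᶻ-cong λ x → ≡.sym (∑T-first x (side x))) (≡.sym ∑³T))
              (≡.trans (eq (+ 3 * ∑³ F) (∑³ T)) (≡.sym (∑³-⊕ (∑³-cyclic F) (∑³-⊙ (- 1ℤ) refl)))))
            (∑ᶻ-nonneg λ x → ∑ᶻ-nonneg λ y → ∑ᶻ-nonneg λ z → nonneg-by (pointwise x y z)
              (0≤+ {2} ⊠ 0≤T x y z ⊠ (0≤a v x ⊠ 0≤a v y ⊠ 0≤a v z ⊞ 0≤1-a v x ⊠ 0≤1-a v y ⊠ 0≤1-a v z)))
            where
            F : Fin n → Fin n → Fin n → ℤ
            F x y z = T x y z * side x y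
            eq : ∀ p q → p - q ≡ p + (- 1ℤ) * q
            eq = solve-∀
            -- The three values of `side` add up to 1, plus 2 when all corners lie on one side.
            ring : ∀ t p q r →
              t * (p * q + (1ℤ - p) * (1ℤ - q)) + t * (q * r + (1ℤ - q) * (1ℤ - r))
              + t * (r * p + (1ℤ - r) * (1ℤ - p)) + (- 1ℤ) * t
              ≡ + 2 * t * (p * q * r + (1ℤ - p) * (1ℤ - q) * (1ℤ - r))
            ring = solve-∀
            pointwise : ∀ x y z → F x y z + F y z x + F z x y + (- 1ℤ) * T x y z
              ≡ + 2 * T x y z * (p x * p y * p z + q x * q y * q z)
            pointwise x y z rewrite T-rotate x y z | T-rotate y z x | T-rotate x y z =
              ring (T x y z) (p x) (p y) (p z)

        -- The endpoints of an edge outside N(v) share at most b of the d(v) vertices of N(v),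
        -- so together they miss at least d(v) - b of them.
        outer-edges : 0ℤ ≤ + 2 * (N * R) - (d v - b) * Y
        outer-edges = nonneg-by
          (≡.trans (eq₀ (N * R) (d v) b Y)
            (≡.sym (≡.trans
              (∑ᶻ-cong λ x → ((b - d v) ⊙ refl) ⊕ refl ⊕ refl)
              (((b - d v) ⊙ refl) ⊕ Rx ⊕ Ry))))
          (∑ᶻ-nonneg λ x → ∑ᶻ-nonneg λ y → nonneg-by (eq₃ (a x y) b (c x y) (d v) (q x) (q y) (g x) (g y))
            (0≤1-a v x ⊠ 0≤1-a v y ⊠ (book x y ⊞ 0≤a x y ⊠ missed x y)
             ⊞ outside x y ⊠ (0≤1-a v x ⊠ 0≤g x) ⊞ outside′ x y ⊠ (0≤1-a v y ⊠ 0≤g y)))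
          where
          eq₀ : ∀ u d b Y → + 2 * u - (d - b) * Y ≡ (b - d) * Y + u + u
          eq₀ = solve-∀
          -- The misses `g x` and `g y` are charged to every pair, adjacent or not, so each of the
          -- two sums is `N * R`.
          Ry : ∑ᶻ (λ x → ∑ᶻ λ y → q y * g y) ≡ N * R
          Ry = ≡.trans (∑ᶻ-const n R) (ℤ.*-comm R N)
          Rx : ∑ᶻ (λ x → ∑ᶻ λ y → q x * g x) ≡ N * R
          Rx = ≡.trans (∑ᶻ-comm λ x y → q x * g x) Ry
          1-pq : ∀ {i j} → 0ℤ ≤ 1ℤ - i → 0ℤ ≤ 1ℤ - j → 0ℤ ≤ i → 0ℤ ≤ 1ℤ - i * j
          1-pq {i} {j} 0≤1-i 0≤1-j 0≤i = nonneg-by (eq i j) (0≤1-i ⊞ 0≤i ⊠ 0≤1-j)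
            where
            eq : ∀ i j → 1ℤ - i * j ≡ (1ℤ - i) + i * (1ℤ - j)
            eq = solve-∀
          1-q : ∀ x → 0ℤ ≤ 1ℤ - q x
          1-q x = nonneg-by (eq (a v x)) (0≤a v x)
            where
            eq : ∀ i → 1ℤ - (1ℤ - i) ≡ i
            eq = solve-∀
          outside : ∀ x y → 0ℤ ≤ 1ℤ - a x y * q y
          outside x y = 1-pq (0≤1-a x y) (1-q y) (0≤a x y)
          outside′ : ∀ x y → 0ℤ ≤ 1ℤ - a x y * q x
          outside′ x y = 1-pq (0≤1-a x y) (1-q x) (0≤a x y)
          missed : ∀ x y → 0ℤ ≤ c x y + (- 1ℤ) * d v + g x + g y
          missed x y = nonneg-by (≡.sym (refl ⊕ (- 1ℤ) ⊙ refl ⊕ refl ⊕ refl))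
            (∑ᶻ-nonneg λ u → nonneg-by (eq (a x u) (a y u) (p u))
              (0≤a v u ⊠ (0≤1-a x u ⊠ 0≤1-a y u) ⊞ 0≤1-a v u ⊠ (0≤a x u ⊠ 0≤a y u)))
            where
            eq : ∀ α β p → α * β + (- 1ℤ) * p + p * (1ℤ - α) + p * (1ℤ - β)
               ≡ p * ((1ℤ - α) * (1ℤ - β)) + (1ℤ - p) * (α * β)
            eq = solve-∀
          eq₃ : ∀ a b c d q r g h → (b - d) * (a * (q * r)) + q * g + r * h
              ≡ q * r * (a * (b - c) + a * (c + (- 1ℤ) * d + g + h))
                + (1ℤ - a * r) * (q * g) + (1ℤ - a * q) * (r * h)
          eq₃ = solve-∀

        R-as-link : R ≡ ∑ᶻ λ u → a v u * r v u
        R-as-link = ≡.trans (∑ᶻ-cong λ x → ≡.sym (q x ⊙ refl))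
          (≡.trans (∑ᶻ-comm λ x u → q x * (p u * (1ℤ - a x u)))
          (∑ᶻ-cong λ u → ≡.trans
            (∑ᶻ-cong λ x → ≡.trans (cong (λ s → q x * (p u * (1ℤ - s))) (a-sym x u)) (reorder (q x) (p u) (1ℤ - a u x)))
            (p u ⊙ refl)))
          where
          reorder : ∀ q p s → q * (p * s) ≡ p * (q * s)
          reorder = solve-∀

        -- Counting `R` from its ends `u` in N(v) gives the sum of `r v u`. Split
        -- `b r = (b - c) r + c r`: the first part sums to `W v`, and `r ≤ N` bounds the second by
        -- `N * ℓ v`.
        missing-pairs : 0ℤ ≤ W v + N * ℓ v - b * R
        missing-pairs = nonneg-by
          (≡.trans (cong (λ s → W v + N * ℓ v - b * s) R-as-link)
            (≡.trans (eq (W v + N * ℓ v) b _) (≡.sym (refl ⊕ N ⊙ refl ⊕ (- b) ⊙ refl))))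
          (∑ᶻ-nonneg λ u → nonneg-by (ring (a v u) b (c v u) (r v u) N)
            (0≤a v u ⊠ 0≤c v u ⊠ r≤N u))
          where
          eq : ∀ w b s → w - b * s ≡ w + (- b) * s
          eq = solve-∀
          ring : ∀ a b c r N → a * (b - c) * r + N * (a * c) + (- b) * (a * r) ≡ a * c * (N + (- 1ℤ) * r)
          ring = solve-∀
          expand : ∀ α β → 1ℤ + (- 1ℤ) * ((1ℤ - α) * (1ℤ - β)) ≡ α + (1ℤ - α) * β
          expand = solve-∀
          r≤N : ∀ u → 0ℤ ≤ N + (- 1ℤ) * r v u
          r≤N u = nonneg-by
            (≡.sym (≡.trans (∑ᶻ-const n 1ℤ) (ℤ.*-identityˡ N) ⊕ (- 1ℤ) ⊙ refl))
            (∑ᶻ-nonneg λ x → nonneg-by (expand (a v x) (a u x)) (0≤a v x ⊞ 0≤1-a v x ⊠ 0≤a u x))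

      -- The lower bound on triangles in a dense graph with `4b ≤ N` and at least one triangle.

      module DenseRegime (0<N : 0ℤ < N) (4b≤N : 0ℤ ≤ N - + 4 * b)
        (dense : 0ℤ ≤ ∑ᶻ d + ∑ᶻ d - N * N) (0<τ : 0ℤ < τ) where

        0≤N : 0ℤ ≤ N
        0≤N = 0≤+

        0≤K : ∀ x → 0ℤ ≤ K x
        0≤K x = ∑ᶻ-nonneg λ y → ∑ᶻ-nonneg λ z → 0≤T x y z ⊠ 0≤k x y z

        b≤N : 0ℤ ≤ N - b
        b≤N = nonneg-by (eq N b) (4b≤N ⊞ 0≤+ {3} ⊠ 0≤b)
          where
          eq : ∀ N b → N - b ≡ N - + 4 * b + + 3 * b
          eq = solve-∀

        b²≤N² : 0ℤ ≤ N * N - b * b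
        b²≤N² = nonneg-by (eq N b) (b≤N ⊠ (0≤N ⊞ 0≤b))
          where
          eq : ∀ N b → N * N - b * b ≡ (N - b) * (N + b)
          eq = solve-∀

        module _ (v : Fin n) where
          open AroundVertex v

          -- `bound` collects what each case below needs to pay for `τ * deficit`: `144 = 2 * 72`
          -- for large `W`, `432 = 108 * 4` and `108` for the link dichotomy, and `72 = 2 * 36` for
          -- low degree.
          D V₁ deficit bound : ℤ
          D       = d v - b
          V₁      = (+ 2 * d v - N) * (+ 2 * d v - N)
          deficit = + 2 * (b * b) - ℓ v
          bound   = N * N * (+ 144 * W v + + 432 * X v + + 108 * K v) + + 72 * (τ * V₁)

          0≤bound : 0ℤ ≤ bound
          0≤bound = 0≤N ⊠ 0≤N ⊠ (0≤+ {144} ⊠ 0≤W v ⊞ 0≤+ {432} ⊠ 0≤X v ⊞ 0≤+ {108} ⊠ 0≤K v)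
                    ⊞ 0≤+ {72} ⊠ (0≤τ ⊠ 0≤square (+ 2 * d v - N))

          -- From `d - b < N/6` and `b ≤ N/4` follows `d < 5N/12`, so `N - 2d` exceeds `N/6` and
          -- `36 V₁ ≥ N²`. Since `deficit` is at most `2b² ≤ 2N²`, the variance term alone suffices.
          bound-if-low-degree : 0ℤ < - (+ 6 * D - N) → 0ℤ ≤ bound - τ * deficit
          bound-if-low-degree low = nonneg-by (eq N (W v) (X v) (K v) τ V₁ b (ℓ v))
            (0≤N ⊠ 0≤N ⊠ (0≤+ {144} ⊠ 0≤W v ⊞ 0≤+ {432} ⊠ 0≤X v ⊞ 0≤+ {108} ⊠ 0≤K v)
             ⊞ 0≤τ ⊠ 0≤ℓ v ⊞ 0≤+ {2} ⊠ 0≤τ ⊠ (far ⊞ b²≤N²))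
            where
            eq : ∀ N W X K t v b l →
              N * N * (+ 144 * W + + 432 * X + + 108 * K) + + 72 * (t * v) - t * (+ 2 * (b * b) - l)
              ≡ N * N * (+ 144 * W + + 432 * X + + 108 * K) + t * l
                + + 2 * t * ((+ 36 * v - N * N) + (N * N - b * b))
            eq = solve-∀
            gap : 0ℤ ≤ + 6 * (N - + 2 * d v) - N
            gap = nonneg-by (ring N (d v) b) (0≤+ {2} ⊠ <⇒≤ low ⊞ 0≤+ {3} ⊠ 4b≤N)
              where
              ring : ∀ N d b → + 6 * (N - + 2 * d) - N ≡ + 2 * (- (+ 6 * (d - b) - N)) + + 3 * (N - + 4 * b)
              ring = solve-∀
            far : 0ℤ ≤ + 36 * V₁ - N * N
            far = nonneg-by (ring N (d v)) (gap ⊠ (gap ⊞ 0≤N ⊞ 0≤N))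
              where
              ring : ∀ N d → + 36 * ((+ 2 * d - N) * (+ 2 * d - N)) - N * N
                   ≡ (+ 6 * (N - + 2 * d) - N) * (+ 6 * (N - + 2 * d) - N + N + N)
              ring = solve-∀

          bound-if-W-large : 0ℤ ≤ + 72 * W v - τ → 0ℤ ≤ bound - τ * deficit
          bound-if-W-large heavy = nonneg-by (eq N (W v) (X v) (K v) τ V₁ b (ℓ v))
            (0≤N ⊠ 0≤N ⊠ (0≤+ {432} ⊠ 0≤X v ⊞ 0≤+ {108} ⊠ 0≤K v) ⊞ 0≤+ {72} ⊠ (0≤τ ⊠ 0≤square (+ 2 * d v - N))
             ⊞ 0≤τ ⊠ 0≤ℓ v ⊞ 0≤+ {2} ⊠ (0≤N ⊠ 0≤N) ⊠ heavy ⊞ 0≤+ {2} ⊠ 0≤τ ⊠ b²≤N²)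
            where
            eq : ∀ N W X K t v b l →
              N * N * (+ 144 * W + + 432 * X + + 108 * K) + + 72 * (t * v) - t * (+ 2 * (b * b) - l)
              ≡ N * N * (+ 432 * X + + 108 * K) + + 72 * (t * v) + t * l
                + + 2 * (N * N) * (+ 72 * W - t) + + 2 * t * (N * N - b * b)
            eq = solve-∀

          -- Chaining the three inequalities around `v` with `D ≥ N/6` gives `τ ≤ 3bℓ + 36W + 36Nℓ`;
          -- multiplying by `6D` avoids division. As `36W < τ/2` and `b ≤ N`, this yields
          -- `τ ≤ 78Nℓ`, with room to spare.
          ℓ-large : 0ℤ ≤ + 6 * D - N → 0ℤ < - (+ 72 * W v - τ) → 0ℤ ≤ + 108 * (N * ℓ v) - τ
          ℓ-large high light = nonneg-by (ring N b (ℓ v) (W v) τ)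
            (0≤+ {2} ⊠ cancel-nonneg 0<6D scaled ⊞ <⇒≤ light ⊞ 0≤+ {6} ⊠ (b≤N ⊠ 0≤ℓ v) ⊞ 0≤+ {30} ⊠ (0≤N ⊠ 0≤ℓ v))
            where
            ring : ∀ N b l W t → + 108 * (N * l) - t
              ≡ + 2 * (+ 3 * (b * l) + + 36 * W + + 36 * (N * l) - t) + (- (+ 72 * W - t))
                + + 6 * ((N - b) * l) + + 30 * (N * l)
            ring = solve-∀
            0<6D : 0ℤ < + 6 * D
            0<6D = ℤ.<-≤-trans 0<N (ℤ.0≤i-j⇒j≤i high)
            0≤D : 0ℤ ≤ D
            0≤D = cancel-nonneg {+ 6} (+<+ (ℕ.s≤s ℕ.z≤n)) (<⇒≤ 0<6D)
            scaled : 0ℤ ≤ + 6 * D * (+ 3 * (b * ℓ v) + + 36 * W v + + 36 * (N * ℓ v) - τ)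
            scaled = nonneg-by (ring′ D b (ℓ v) (W v) N τ Y R)
              (0≤+ {6} ⊠ (0≤D ⊠ triangles≤inner-edges) ⊞ 0≤+ {18} ⊠ 0≤b ⊠ outer-edges
               ⊞ 0≤+ {36} ⊠ 0≤N ⊠ missing-pairs ⊞ 0≤+ {36} ⊠ high ⊠ (0≤W v ⊞ 0≤N ⊠ 0≤ℓ v))
              where
              ring′ : ∀ D b l W N t Y R → + 6 * D * (+ 3 * (b * l) + + 36 * W + + 36 * (N * l) - t)
                ≡ + 6 * (D * (+ 3 * (b * (l + Y)) - t)) + + 18 * b * (+ 2 * (N * R) - D * Y)
                  + + 36 * N * (W + N * l - b * R) + + 36 * (+ 6 * D - N) * (W + N * l)
              ring′ = solve-∀

          -- Replace `τ` by `108Nℓ`; then `link-dichotomy` bounds `ℓ * deficit` by `b (4X + K)`, and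
          -- `b ≤ N`.
          bound-if-ℓ-large : 0ℤ ≤ + 108 * (N * ℓ v) - τ → 0ℤ ≤ deficit → 0ℤ ≤ bound - τ * deficit
          bound-if-ℓ-large large 0≤deficit = nonneg-by (eq N (W v) (X v) (K v) τ V₁ b (ℓ v))
            (0≤N ⊠ 0≤N ⊠ (0≤+ {144} ⊠ 0≤W v) ⊞ 0≤+ {72} ⊠ (0≤τ ⊠ 0≤square (+ 2 * d v - N))
             ⊞ large ⊠ 0≤deficit ⊞ 0≤+ {108} ⊠ 0≤N ⊠ link-dichotomy v
             ⊞ 0≤+ {108} ⊠ 0≤N ⊠ (b≤N ⊠ (0≤+ {4} ⊠ 0≤X v ⊞ 0≤K v)))
            where
            eq : ∀ N W X K t v b l →
              N * N * (+ 144 * W + + 432 * X + + 108 * K) + + 72 * (t * v) - t * (+ 2 * (b * b) - l)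
              ≡ N * N * (+ 144 * W) + + 72 * (t * v) + (+ 108 * (N * l) - t) * (+ 2 * (b * b) - l)
                + + 108 * N * (b * (+ 4 * X + K) - l * (+ 2 * (b * b) - l))
                + + 108 * N * ((N - b) * (+ 4 * X + K))
            eq = solve-∀

          bound-if-no-deficit : 0ℤ < - deficit → 0ℤ ≤ bound - τ * deficit
          bound-if-no-deficit full = nonneg-by (eq bound τ deficit) (0≤bound ⊞ 0≤τ ⊠ <⇒≤ full)
            where
            eq : ∀ p t q → p - t * q ≡ p + t * (- q)
            eq = solve-∀

          -- Vertices of degree well below N/2 are paid for by the degree variance, vertices
          -- with large W by ΣW; at any other vertex ℓ(v) is at least a constant times τ/N,
          -- hence not close to 0 in link-dichotomy.
          vertex-bound : 0ℤ ≤ bound - τ * deficit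
          vertex-bound = by-sign (+ 6 * D - N)
            (λ high → by-sign (+ 72 * W v - τ) bound-if-W-large
              λ light → by-sign deficit (bound-if-ℓ-large (ℓ-large high light)) bound-if-no-deficit)
            bound-if-low-degree

        -- Every term on the right of `main-identity` is nonnegative and `τ` is positive: the
        -- classical lower bound `N/6` on the book number.
        0≤Δ : 0ℤ ≤ Δ
        0≤Δ = cancel-nonneg 0<τ (nonneg-by (≡.trans (ℤ.*-comm τ Δ) main-identity)
          (0≤+ {3} ⊠ ∑ᶻ-nonneg 0≤X ⊞ 0≤+ {3} ⊠ ∑ᶻ-nonneg 0≤W ⊞ 0≤+ {3} ⊠ 0≤b ⊠ 0≤ΣS dense ⊞ 0≤+ {2} ⊠ 0≤ΣM))

        τ≤bN² : 0ℤ ≤ b * N * N + (- 1ℤ) * τ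
        τ≤bN² = nonneg-by (≡.sym (∑ᶻ-const n (b * N) ⊕ (- 1ℤ) ⊙ refl))
          (∑ᶻ-nonneg λ x → nonneg-by (eq (b * N) (ℓ x)) (ℓ≤bN x))
          where
          eq : ∀ p q → p + (- 1ℤ) * q ≡ p - q
          eq = solve-∀

        vertex-sum : 0ℤ ≤ N * N * (+ 144 * ΣW + + 432 * ΣX + + 108 * ∑ᶻ K)
                        + + 72 * (τ * V) + (- 1ℤ) * (τ * (+ 2 * (b * b) * N + (- 1ℤ) * τ))
        vertex-sum = nonneg-by
          (≡.sym ((N * N) ⊙ (+ 144 ⊙ refl ⊕ + 432 ⊙ refl ⊕ + 108 ⊙ refl) ⊕ + 72 ⊙ (τ ⊙ refl)
            ⊕ (- 1ℤ) ⊙ (τ ⊙ (∑ᶻ-const n (+ 2 * (b * b)) ⊕ (- 1ℤ) ⊙ refl))))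
          (∑ᶻ-nonneg λ v → nonneg-by (eq (bound v) τ (+ 2 * (b * b)) (ℓ v)) (vertex-bound v))
          where
          eq : ∀ s t p l → s + (- 1ℤ) * (t * (p + (- 1ℤ) * l)) ≡ s - t * (p - l)
          eq = solve-∀

        -- After cancelling `τ`, the summed vertex bounds give `τ ≥ 2b²N - 288N²Δ`. Multiply by 18
        -- and use `36b² ≥ N²`; hence `5184 = 18 * 288`.
        many-triangles : 0ℤ ≤ + 18 * τ + + 5184 * (N * N * Δ) - N * N * N
        many-triangles = nonneg-by (ring N b τ)
          (0≤+ {18} ⊠ cancel-nonneg 0<τ scaled ⊞ 0≤N ⊠ (0≤Δ ⊠ (0≤+ {6} ⊠ 0≤b ⊞ 0≤N)))
          where
          ring : ∀ N b t → + 18 * t + + 5184 * (N * N * (+ 6 * b - N)) - N * N * N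
            ≡ + 18 * (+ 288 * (N * N) * (+ 6 * b - N) - + 2 * (b * b) * N + t)
              + N * ((+ 6 * b - N) * (+ 6 * b + N))
          ring = solve-∀
          move : ∀ t u v p → p ≡ u * t → t * (+ 288 * v * u - + 2 * (b * b) * N + t)
            ≡ + 288 * v * p - t * (+ 2 * (b * b) * N - t)
          move t u v _ refl = eq t u v b N
            where
            eq : ∀ t u v b N → t * (+ 288 * v * u - + 2 * (b * b) * N + t)
               ≡ + 288 * v * (u * t) - t * (+ 2 * (b * b) * N - t)
            eq = solve-∀
          -- The factor 288 makes each term of `main-identity` cover its share:
          -- `3 * 288 = 432 + 432` for `X` and `144 + 720` for `W`, `2 * 288 = 108 + 468` for `M`.
          -- The `S` term covers `144 τ S`, which replaces `72 τ V`, because `τ ≤ bN²`.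
          gather : ∀ N b t X W S M K V →
            + 288 * (N * N) * (+ 3 * X + + 3 * W + + 3 * b * S + + 2 * M) - t * (+ 2 * (b * b) * N - t)
            ≡ N * N * (+ 144 * W + + 432 * X + + 108 * K) + + 72 * (t * V)
                + (- 1ℤ) * (t * (+ 2 * (b * b) * N + (- 1ℤ) * t))
              + N * N * (+ 432 * X + + 720 * W + + 468 * M + + 108 * (M - K))
              + + 72 * (t * (+ 2 * S - V)) + + 144 * S * ((b * N * N + (- 1ℤ) * t) + + 5 * (b * (N * N)))
          gather = solve-∀
          scaled : 0ℤ ≤ τ * (+ 288 * (N * N) * Δ - + 2 * (b * b) * N + τ)
          scaled = nonneg-by
            (≡.trans (move τ Δ (N * N) _ (≡.sym main-identity)) (gather N b τ ΣX ΣW ΣS ΣM (∑ᶻ K) V))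
            (vertex-sum
             ⊞ 0≤N ⊠ 0≤N ⊠ (0≤+ {432} ⊠ ∑ᶻ-nonneg 0≤X ⊞ 0≤+ {720} ⊠ ∑ᶻ-nonneg 0≤W ⊞ 0≤+ {468} ⊠ 0≤ΣM
                            ⊞ 0≤+ {108} ⊠ K≤M)
             ⊞ 0≤+ {72} ⊠ (0≤τ ⊠ degree-variance dense)
             ⊞ 0≤+ {144} ⊠ 0≤ΣS dense ⊠ (τ≤bN² ⊞ 0≤+ {5} ⊠ (0≤b ⊠ (0≤N ⊠ 0≤N))))

-- Maxima, and sorting a two-colouring by a permutation.

maxOver-upper : ∀ {n} (f : Fin n → ℕ) i → f i ℕ.≤ maxOver n f
maxOver-upper f Fin.zero    = ℕ.m≤m⊔n _ _
maxOver-upper f (Fin.suc i) = ℕ.≤-trans (maxOver-upper (λ j → f (Fin.suc j)) i) (ℕ.m≤n⊔m (f Fin.zero) _)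

toℕ-punchOut-fromℕ : ∀ {n} {k : Fin (suc n)} (≢k : fromℕ n ≢ k) → toℕ (punchOut ≢k) ≡ toℕ k
toℕ-punchOut-fromℕ {zero}  {Fin.zero}  ≢k = contradiction refl ≢k
toℕ-punchOut-fromℕ {suc n} {Fin.zero}  ≢k = refl
toℕ-punchOut-fromℕ {suc n} {Fin.suc k} ≢k = cong suc (toℕ-punchOut-fromℕ _)

count : ∀ {n} → (Fin n → Bool) → ℕ
count {n} χ = ∑ n λ i → indicator (χ i)

count≤n : ∀ {n} (χ : Fin n → Bool) → count χ ℕ.≤ n
count≤n {zero}  χ = ℕ.z≤n
count≤n {suc n} χ with χ Fin.zero
... | true  = ℕ.s≤s (count≤n λ i → χ (Fin.suc i))
... | false = ℕ.m≤n⇒m≤1+n (count≤n λ i → χ (Fin.suc i))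

-- Induction on the first vertex: if coloured `true` it stays in front, otherwise it moves to the
-- last position, which leaves the indices of the other positions unchanged. The sorted form is the
-- one used by `balancedAdj`.
sort-colouring : ∀ {n} (χ : Fin n → Bool) →
                 Σ (Permutation′ n) λ σ → ∀ i → χ (σ ⟨$⟩ʳ i) ≡ (toℕ i ℕ.<ᵇ count χ)
sort-colouring {zero}  χ = Perm.id , λ ()
sort-colouring {suc n} χ with χ Fin.zero in χ0 | sort-colouring (λ i → χ (Fin.suc i))
... | true  | σ , sorted = lift₀ σ , λ { Fin.zero → χ0 ; (Fin.suc i) → sorted i }
... | false | σ , sorted = insert (fromℕ n) Fin.zero σ , sorted′
  where
  c = count λ i → χ (Fin.suc i)
  last≮c : ∀ m → c ℕ.≤ m → (m ℕ.<ᵇ c) ≡ false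
  last≮c m c≤m with m ℕ.<ᵇ c | ℕ.<ᵇ⇒< m c
  ... | true  | m<c = contradiction (m<c _) (ℕ.≤⇒≯ c≤m)
  ... | false | _   = refl
  sorted′ : ∀ k → χ (insert (fromℕ n) Fin.zero σ ⟨$⟩ʳ k) ≡ (toℕ k ℕ.<ᵇ c)
  sorted′ k with fromℕ n ≟ k
  ... | yes refl = ≡.trans χ0 (≡.sym (last≮c _
                     (subst (c ℕ.≤_) (≡.sym (toℕ-fromℕ n)) (count≤n λ i → χ (Fin.suc i)))))
  ... | no  ≢k   = ≡.trans (sorted (punchOut ≢k)) (cong (ℕ._<ᵇ c) (toℕ-punchOut-fromℕ ≢k))

-- From graphs to integer weights, and the triangle-free case.

module IntegerGraph where
  open IntegerSums
  open Weights

  +∑ : ∀ n (f : Fin n → ℕ) → + ∑ n f ≡ ∑ᶻ λ i → + f i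
  +∑ zero    f = ≡.sym (∑ᶻ-zero _)
  +∑ (suc n) f = ≡.trans (cong (λ s → + f Fin.zero + s) (+∑ n λ i → f (Fin.suc i))) (≡.sym (∑ᶻ-suc _))

  ⟦_⟧ : Bool → ℤ
  ⟦ p ⟧ = + indicator p

  ⟦∧⟧ : ∀ p q → ⟦ p ∧ q ⟧ ≡ ⟦ p ⟧ * ⟦ q ⟧
  ⟦∧⟧ false q     = refl
  ⟦∧⟧ true  false = refl
  ⟦∧⟧ true  true  = refl

  ⟦∧⟧-cong : ∀ p {q s} → ⟦ q ⟧ ≡ s → ⟦ p ∧ q ⟧ ≡ ⟦ p ⟧ * s
  ⟦∧⟧-cong p {q} e = ≡.trans (⟦∧⟧ p q) (cong (⟦ p ⟧ *_) e)

  0≤1-⟦⟧ : ∀ p → 0ℤ ≤ 1ℤ - ⟦ p ⟧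
  0≤1-⟦⟧ false = 0≤+
  0≤1-⟦⟧ true  = 0≤+

  module GraphBridge {n : ℕ} (G : Graph n) where

    a L : Fin n → Fin n → ℤ
    a x y = ⟦ adj G x y ⟧
    L x y = ⟦ x <ᶠ y ⟧

    a-sym : ∀ x y → a x y ≡ a y x
    a-sym x y = cong ⟦_⟧ (Graph.sym G x y)

    0≤a : ∀ x y → 0ℤ ≤ a x y
    0≤a x y = 0≤+

    0≤1-a : ∀ x y → 0ℤ ≤ 1ℤ - a x y
    0≤1-a x y = 0≤1-⟦⟧ (adj G x y)

    module Weighted = WeightedGraph a a-sym 0≤a 0≤1-a
    open Weighted using (N; d; c; τ)

    codegree≡c : ∀ x y → + codegree G x y ≡ c x y
    codegree≡c x y = ≡.trans (+∑ n _) (∑ᶻ-cong λ w → ⟦∧⟧ (adj G x w) (adj G y w))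

    codegree≤book : ∀ x y → 0ℤ ≤ a x y * (+ bookNumber G - c x y)
    codegree≤book x y = subst (λ s → 0ℤ ≤ a x y * (+ bookNumber G - s)) (codegree≡c x y) (bound (adj G x y) refl)
      where
      inner : Fin n → Fin n → ℕ
      inner u v = if adj G u v then codegree G u v else 0
      inner≤book : inner x y ℕ.≤ bookNumber G
      inner≤book = ℕ.≤-trans (maxOver-upper (inner x) y) (maxOver-upper (λ u → maxOver n (inner u)) x)
      bound : ∀ p → adj G x y ≡ p → 0ℤ ≤ ⟦ p ⟧ * (+ bookNumber G - + codegree G x y)
      bound false _ = 0≤+
      bound true  e = 0≤+ {1} ⊠ ℤ.i≤j⇒0≤j-i (+≤+
        (subst (λ p → (if p then codegree G x y else 0) ℕ.≤ bookNumber G) e inner≤book))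

    L-total : ∀ x y → a x y ≡ 0ℤ ⊎ L y x ≡ 1ℤ - L x y
    L-total x y with toℕ x ℕ.<ᵇ toℕ y | ℕ.<ᵇ-reflects-< (toℕ x) (toℕ y)
                   | toℕ y ℕ.<ᵇ toℕ x | ℕ.<ᵇ-reflects-< (toℕ y) (toℕ x)
    ... | true  | _       | false | _       = inj₂ refl
    ... | false | _       | true  | _       = inj₂ refl
    ... | true  | ofʸ x<y | true  | ofʸ y<x = contradiction y<x (ℕ.<-asym x<y)
    ... | false | ofⁿ x≮y | false | ofⁿ y≮x =
      inj₁ (cong ⟦_⟧ (≡.trans (cong (adj G x) (≡.sym x≡y)) (irrefl G x)))
      where
      x≡y : x ≡ y
      x≡y = toℕ-injective (ℕ.≤-antisym (ℕ.≮⇒≥ y≮x) (ℕ.≮⇒≥ x≮y))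

    open Weighted.Orientation L (λ x y → 0≤+) (λ x y → 0≤1-⟦⟧ (x <ᶠ y)) L-total

    edges : + edgeCount G ≡ E
    edges = ≡.trans (+∑ n _) (∑ᶻ-cong λ x → ≡.trans (+∑ n _) (∑ᶻ-cong λ y → ⟦∧⟧ (x <ᶠ y) (adj G x y)))

    triangles : + triangleCount G ≡ ∑³ H
    triangles = ≡.trans (+∑ n _) (∑ᶻ-cong λ x → ≡.trans (+∑ n _) (∑ᶻ-cong λ y → ≡.trans (+∑ n _)
      (∑ᶻ-cong λ z → indicators (x <ᶠ y) (y <ᶠ z) (adj G x y) (adj G y z) (adj G x z))))
      where
      reorder : ∀ l m p q r → l * (m * (p * (q * r))) ≡ p * (r * q) * (l * m)
      reorder = solve-∀
      indicators : ∀ l m p q r → ⟦ l ∧ m ∧ p ∧ q ∧ r ⟧ ≡ ⟦ p ⟧ * (⟦ r ⟧ * ⟦ q ⟧) * (⟦ l ⟧ * ⟦ m ⟧)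
      indicators l m p q r = ≡.trans
        (⟦∧⟧-cong l (⟦∧⟧-cong m (⟦∧⟧-cong p (⟦∧⟧ q r))))
        (reorder ⟦ l ⟧ ⟦ m ⟧ ⟦ p ⟧ ⟦ q ⟧ ⟦ r ⟧)

    τ≤6t : 0ℤ ≤ + 6 * + triangleCount G - τ
    τ≤6t = nonneg-by (cong (λ s → + 6 * s - τ) triangles) τ≤6∑H

    dense : n ℕ.* n ℕ.≤ 4 ℕ.* edgeCount G → 0ℤ ≤ ∑ᶻ d + ∑ᶻ d - N * N
    dense n²≤4e = nonneg-by
      (eq (∑ᶻ d) E (N * N))
      (0≤+ {2} ⊠ 2E≤∑d ⊞ subst (λ s → 0ℤ ≤ + 4 * s - N * N) edges
        (ℤ.i≤j⇒0≤j-i (ℤ.≤-trans (ℤ.≤-reflexive (≡.sym (ℤ.pos-* n n)))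
          (ℤ.≤-trans (+≤+ n²≤4e) (ℤ.≤-reflexive (ℤ.pos-* 4 (edgeCount G)))))))
      where
      eq : ∀ D E s → D + D - s ≡ + 2 * (D - (E + E)) + (+ 4 * E - s)
      eq = solve-∀

  ⟦⟧-complementary : ∀ p q → ⟦ p ⟧ * ⟦ q ⟧ ≡ 0ℤ → (1ℤ - ⟦ p ⟧) * (1ℤ - ⟦ q ⟧) ≡ 0ℤ → q ≡ not p
  ⟦⟧-complementary true  false _ _ = refl
  ⟦⟧-complementary false true  _ _ = refl
  ⟦⟧-complementary true  true  () _
  ⟦⟧-complementary false false _ ()

  -- With b = 1 the main identity writes 0 = (6b - N) τ as a sum of nonnegative terms, so each
  -- of them vanishes: the endpoints of an edge have complementary neighbourhoods, and the
  -- graph is N/2-regular.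
  module TriangleFree {n : ℕ} (G : Graph (suc n)) (τ≤0 : GraphBridge.Weighted.τ G ≤ 0ℤ)
    (dense : 0ℤ ≤ ∑ᶻ (GraphBridge.Weighted.d G) + ∑ᶻ (GraphBridge.Weighted.d G) - + suc n * + suc n)
    where

    open GraphBridge G hiding (dense)
    open Weighted

    ac≡0 : ∀ x y → a x y * c x y ≡ 0ℤ
    ac≡0 x y = ∑ᶻ≡0 (λ z → 0≤a x z ⊠ 0≤c x z) (ℤ.≤-reflexive (∑ᶻ≡0 0≤ℓ τ≤0 x)) y

    -- Codegrees vanish on edges, so 0 would also bound them; the positive bound 1 keeps the `W` and
    -- `S` terms of `main-identity` alive.
    book : ∀ x y → 0ℤ ≤ a x y * (1ℤ - c x y)
    book x y = nonneg-by (≡.trans (eq (a x y) (c x y)) (cong (λ s → a x y - s) (ac≡0 x y)))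
      (nonneg-by (ℤ.+-identityʳ (a x y)) (0≤a x y))
      where
      eq : ∀ p q → p * (1ℤ - q) ≡ p - p * q
      eq = solve-∀

    open BookBound 1ℤ 0≤+ book

    0≤ΣX : 0ℤ ≤ ΣX
    0≤ΣX = ∑ᶻ-nonneg 0≤X

    0≤ΣW : 0ℤ ≤ ΣW
    0≤ΣW = ∑ᶻ-nonneg 0≤W

    -- `main-identity` is doubled so that `2 ΣS` appears, the quantity that dominates `V`.
    balance : + 6 * ΣX + + 6 * ΣW + + 3 * (+ 2 * ΣS) + + 4 * ΣM ≡ 0ℤ
    balance = ≡.trans (eq ΣX ΣW ΣS ΣM) (≡.trans (cong (+ 2 *_) (≡.sym main-identity))
      (≡.trans (cong (λ t → + 2 * (Δ * t)) (ℤ.≤-antisym τ≤0 0≤τ)) (absorb Δ)))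
      where
      eq : ∀ X W S M → + 6 * X + + 6 * W + + 3 * (+ 2 * S) + + 4 * M
         ≡ + 2 * (+ 3 * X + + 3 * W + + 3 * 1ℤ * S + + 2 * M)
      eq = solve-∀
      absorb : ∀ p → + 2 * (p * 0ℤ) ≡ 0ℤ
      absorb = solve-∀

    ΣW≤0 : ΣW ≤ 0ℤ
    ΣW≤0 = ℤ.0≤i-j⇒j≤i (nonneg-by
      (≡.trans (cong (λ s → s - ΣW) (≡.sym balance)) (eq ΣX ΣW (+ 2 * ΣS) ΣM))
      (0≤+ {6} ⊠ 0≤ΣX ⊞ 0≤+ {5} ⊠ 0≤ΣW ⊞ 0≤+ {3} ⊠ (0≤+ {2} ⊠ 0≤ΣS dense) ⊞ 0≤+ {4} ⊠ 0≤ΣM))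
      where
      eq : ∀ X W S M → + 6 * X + + 6 * W + + 3 * S + + 4 * M - W ≡ + 6 * X + + 5 * W + + 3 * S + + 4 * M
      eq = solve-∀

    V≤0 : V ≤ 0ℤ
    V≤0 = ℤ.0≤i-j⇒j≤i (nonneg-by
      (≡.trans (cong (λ s → s - V) (≡.sym balance)) (eq ΣX ΣW (+ 2 * ΣS) ΣM V))
      (0≤+ {6} ⊠ 0≤ΣX ⊞ 0≤+ {6} ⊠ 0≤ΣW ⊞ 0≤+ {2} ⊠ (0≤+ {2} ⊠ 0≤ΣS dense) ⊞ 0≤+ {4} ⊠ 0≤ΣM ⊞ degree-variance dense))
      where
      eq : ∀ X W S M V → + 6 * X + + 6 * W + + 3 * S + + 4 * M - V
         ≡ + 6 * X + + 6 * W + + 2 * S + + 4 * M + (S - V)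
      eq = solve-∀

    2d≡N : ∀ x → + 2 * d x ≡ N
    2d≡N x = ℤ.i-j≡0⇒i≡j (+ 2 * d x) N
      (square≡0 (+ 2 * d x - N) (∑ᶻ≡0 (λ y → 0≤square (+ 2 * d y - N)) V≤0 x))

    complementary : ∀ x y w → adj G x y ≡ true → adj G y w ≡ not (adj G x w)
    complementary x y w xy = ⟦⟧-complementary (adj G x w) (adj G y w)
      (∑ᶻ≡0 (λ z → 0≤a x z ⊠ 0≤a y z) (ℤ.≤-reflexive c≡0) w)
      (∑ᶻ≡0 (λ z → 0≤1-a x z ⊠ 0≤1-a y z) (ℤ.≤-reflexive r≡0) w)
      where
      a≡1 : a x y ≡ 1ℤ
      a≡1 = cong ⟦_⟧ xy
      one-left : ∀ {p} q → p ≡ 1ℤ → p * q ≡ 0ℤ → q ≡ 0ℤ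
      one-left q refl pq≡0 = ≡.trans (≡.sym (ℤ.*-identityˡ q)) pq≡0
      c≡0 : c x y ≡ 0ℤ
      c≡0 = one-left (c x y) a≡1 (ac≡0 x y)
      a[1-c]≡1 : a x y * (1ℤ - c x y) ≡ 1ℤ
      a[1-c]≡1 = ≡.trans (cong₂ (λ s t → s * (1ℤ - t)) a≡1 c≡0) refl
      r≡0 : r x y ≡ 0ℤ
      r≡0 = one-left (r x y) a[1-c]≡1
        (∑ᶻ≡0 (λ z → book x z ⊠ 0≤r x z) (ℤ.≤-reflexive (∑ᶻ≡0 0≤W ΣW≤0 x)) y)

    χ : Fin (suc n) → Bool
    χ = adj G Fin.zero

    neighbour : ∃ λ u → χ u ≡ true
    neighbour with any? (λ u → χ u Bool.≟ true)
    ... | yes found = found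
    ... | no  none  = contradiction (≡.trans (≡.sym (2d≡N Fin.zero)) (cong (+ 2 *_) isolated)) λ ()
      where
      isolated : d Fin.zero ≡ 0ℤ
      isolated = ≡.trans
        (∑ᶻ-cong λ u → cong ⟦_⟧ (Bool.¬-not (λ e → none (u , e))))
        (∑ᶻ-const (suc n) 0ℤ)

    -- A neighbour `x` of the base vertex has the complementary neighbourhood. A non-neighbour `x`
    -- is adjacent to every neighbour `u` of the base vertex, and complementing twice gives it the
    -- base neighbourhood.
    two-coloured : ∀ x y → adj G x y ≡ χ x xor χ y
    two-coloured x y with χ x in χx
    ... | true  = complementary Fin.zero x y χx
    ... | false = begin
      adj G x y              ≡⟨ complementary u x y ux ⟩
      not (adj G u y)        ≡⟨ cong not (complementary Fin.zero u y χu) ⟩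
      not (not (χ y))        ≡⟨ Bool.not-involutive (χ y) ⟩
      χ y                    ∎
      where
      open ≡.≡-Reasoning
      u = proj₁ neighbour
      χu = proj₂ neighbour
      ux : adj G u x ≡ true
      ux = ≡.trans (complementary Fin.zero u x χu) (cong not χx)

    -- Regularity gives the base vertex exactly half of the vertices as neighbours; in particular
    -- the order is even and the division is exact.
    half : suc n ℕ./ 2 ≡ count χ
    half = ≡.trans (cong (ℕ._/ 2) (≡.sym 2·count)) (m*n/n≡m (count χ) 2)
      where
      2·count : count χ ℕ.* 2 ≡ suc n
      2·count = ℤ.+-injective (≡.trans (cong +_ (ℕ.*-comm (count χ) 2))
        (≡.trans (ℤ.pos-* 2 (count χ)) (≡.trans (cong (+ 2 *_) (+∑ (suc n) _)) (2d≡N Fin.zero))))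

    balanced : IsBalancedCompleteBipartite G
    balanced with sort-colouring χ
    ... | σ , sorted = σ , λ i j → ≡.trans (two-coloured (σ ⟨$⟩ʳ i) (σ ⟨$⟩ʳ j))
      (subst (λ h → χ (σ ⟨$⟩ʳ i) xor χ (σ ⟨$⟩ʳ j) ≡ (toℕ i ℕ.<ᵇ h) xor (toℕ j ℕ.<ᵇ h)) (≡.sym half)
        (cong₂ _xor_ (sorted i) (sorted j)))

  -- If `τ ≤ 0` the graph would be balanced complete bipartite; otherwise `many-triangles` applies,
  -- and `τ ≤ 6t` turns `18τ` into `108t`.
  integer-bound : ∀ {n} (G : Graph n) → 1 ℕ.≤ n → n ℕ.* n ℕ.≤ 4 ℕ.* edgeCount G → ¬ IsBalancedCompleteBipartite G →
    0ℤ ≤ + n - + 4 * + bookNumber G →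
    0ℤ ≤ + 108 * + triangleCount G + + 5184 * (+ n * + n * (+ 6 * + bookNumber G - + n)) - + n * + n * + n
  integer-bound {suc n} G 1≤n n²≤4e unbalanced 4b≤n = by-sign (- τ)
    (λ 0≤-τ → contradiction
      (TriangleFree.balanced G (subst (_≤ 0ℤ) (ℤ.neg-involutive τ) (ℤ.neg-mono-≤ 0≤-τ)) (dense n²≤4e)) unbalanced)
    (λ 0<τ → nonneg-by (eq (+ triangleCount G) τ _ _)
      (0≤+ {18} ⊠ τ≤6t ⊞ many-triangles (subst (0ℤ <_) (ℤ.neg-involutive τ) 0<τ)))
    where
    open GraphBridge G
    open Weighted using (τ; module BookBound)
    open BookBound (+ bookNumber G) 0≤+ codegree≤book using (module DenseRegime)
    open DenseRegime (+<+ (ℕ.s≤s ℕ.z≤n)) 4b≤n (dense n²≤4e) using (many-triangles)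
    eq : ∀ t τ p q → + 108 * t + p - q ≡ + 18 * (+ 6 * t - τ) + (+ 18 * τ + p - q)
    eq = solve-∀

-- Passage to rational numbers and choice of the constants.

import Data.Rational as ℚ
import Data.Rational.Properties as ℚ
import Data.Rational.Unnormalised as ℚᵘ
import Data.Rational.Unnormalised.Properties as ℚᵘ

module Rationals where
  open import Data.Rational
  open import Data.Rational.Solver using (module +-*-Solver)
  open +-*-Solver

  ι : ℤ → ℚ
  ι i = i / 1

  -- `i / 1` is computed by normalisation, so the arithmetic of `ι` is checked on unnormalised
  -- fractions with denominator 1.
  toℚᵘ-ι : ∀ i → toℚᵘ (ι i) ℚᵘ.≃ ℚᵘ.mkℚᵘ i 0
  toℚᵘ-ι i = ℚ.toℚᵘ-fromℚᵘ (ℚᵘ.mkℚᵘ i 0)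

  ι-+ : ∀ i j → ι (i ℤ.+ j) ≡ ι i + ι j
  ι-+ i j = ℚ.toℚᵘ-injective (begin-equality
    toℚᵘ (ι (i ℤ.+ j))                    ≃⟨ toℚᵘ-ι (i ℤ.+ j) ⟩
    ℚᵘ.mkℚᵘ (i ℤ.+ j) 0                   ≃⟨ ℚᵘ.*≡* (cong (ℤ._* + 1) (cong₂ ℤ._+_ (≡.sym (ℤ.*-identityʳ i)) (≡.sym (ℤ.*-identityʳ j)))) ⟩
    ℚᵘ.mkℚᵘ i 0 ℚᵘ.+ ℚᵘ.mkℚᵘ j 0          ≃⟨ ℚᵘ.+-cong (toℚᵘ-ι i) (toℚᵘ-ι j) ⟨
    toℚᵘ (ι i) ℚᵘ.+ toℚᵘ (ι j)            ≃⟨ ℚ.toℚᵘ-homo-+ (ι i) (ι j) ⟨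
    toℚᵘ (ι i + ι j)                      ∎)
    where open ℚᵘ.≤-Reasoning

  ι-* : ∀ i j → ι (i ℤ.* j) ≡ ι i * ι j
  ι-* i j = ℚ.toℚᵘ-injective (begin-equality
    toℚᵘ (ι (i ℤ.* j))                    ≃⟨ toℚᵘ-ι (i ℤ.* j) ⟩
    ℚᵘ.mkℚᵘ i 0 ℚᵘ.* ℚᵘ.mkℚᵘ j 0          ≃⟨ ℚᵘ.*-cong (toℚᵘ-ι i) (toℚᵘ-ι j) ⟨
    toℚᵘ (ι i) ℚᵘ.* toℚᵘ (ι j)            ≃⟨ ℚ.toℚᵘ-homo-* (ι i) (ι j) ⟨
    toℚᵘ (ι i * ι j)                      ∎)
    where open ℚᵘ.≤-Reasoning

  ι-neg : ∀ i → ι (ℤ.- i) ≡ - ι i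
  ι-neg i = ℚ.toℚᵘ-injective (begin-equality
    toℚᵘ (ι (ℤ.- i))                      ≃⟨ toℚᵘ-ι (ℤ.- i) ⟩
    ℚᵘ.- ℚᵘ.mkℚᵘ i 0                      ≃⟨ ℚᵘ.-‿cong (toℚᵘ-ι i) ⟨
    ℚᵘ.- toℚᵘ (ι i)                       ≃⟨ ℚ.toℚᵘ-homo‿- (ι i) ⟨
    toℚᵘ (- ι i)                          ∎)
    where open ℚᵘ.≤-Reasoning

  ι-- : ∀ i j → ι (i ℤ.- j) ≡ ι i - ι j
  ι-- i j = ≡.trans (ι-+ i (ℤ.- j)) (cong (λ s → ι i + s) (ι-neg j))

  ι-nonneg : ∀ {i} → 0ℤ ℤ.≤ i → 0ℚ ≤ ι i
  ι-nonneg {+ n} _ = ℚ.nonNegative⁻¹ (ι (+ n)) {{ℚ.normalize-nonNeg n 1}}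

  ι-nonneg⁻¹ : ∀ i → 0ℚ ≤ ι i → 0ℤ ℤ.≤ i
  ι-nonneg⁻¹ i 0≤ιi = subst (0ℤ ℤ.≤_) (ℤ.*-identityʳ i)
    (ℚᵘ.drop-*≤* (ℚᵘ.≤-respʳ-≃ (toℚᵘ-ι i) (ℚ.toℚᵘ-mono-≤ 0≤ιi)))

  infixl 6 _⊞_
  infixl 7 _⊠_

  _⊞_ : ∀ {p q} → 0ℚ ≤ p → 0ℚ ≤ q → 0ℚ ≤ p + q
  _⊞_ = ℚ.+-mono-≤

  _⊠_ : ∀ {p q} → 0ℚ ≤ p → 0ℚ ≤ q → 0ℚ ≤ p * q
  _⊠_ {p} {q} 0≤p 0≤q = subst (_≤ p * q) (ℚ.*-zeroʳ p) (ℚ.*-monoˡ-≤-nonNeg p {{nonNegative 0≤p}} 0≤q)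

  p≤q⇒0≤q-p : ∀ {p q} → p ≤ q → 0ℚ ≤ q - p
  p≤q⇒0≤q-p {p} {q} p≤q = subst (_≤ q - p) (ℚ.+-inverseʳ p) (ℚ.+-monoˡ-≤ (- p) p≤q)

  0≤q-p⇒p≤q : ∀ {p q} → 0ℚ ≤ q - p → p ≤ q
  0≤q-p⇒p≤q {p} {q} 0≤q-p = ℚ.≤-trans (ℚ.≤-reflexive (≡.sym (ℚ.+-identityˡ p)))
    (ℚ.≤-trans (ℚ.+-monoˡ-≤ p 0≤q-p) (ℚ.≤-reflexive (eq q p)))
    where
    eq : ∀ q p → q - p + p ≡ q
    eq = solve 2 (λ q p → q :- p :+ p := q) refl

  -- 4b ≤ (2/3 + 1/16) n whenever ε < 1/4.
  book-below-quarter : ∀ (n b ε : ℚ) → 0ℚ ≤ n → 0ℚ ≤ ε → 0ℚ ≤ + 1 / 4 - ε →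
    0ℚ ≤ (+ 1 / 6 + ε * ε * ε) * n - b → 0ℚ ≤ n - + 4 / 1 * b
  book-below-quarter n b ε 0≤n 0≤ε 0≤¼-ε small = subst (0ℚ ≤_) (≡.sym (eq n b ε))
    (toWitness {a? = 0ℚ ≤? + 4 / 1} _ ⊠ small
     ⊞ toWitness {a? = 0ℚ ≤? + 4 / 1} _ ⊠ (cube ⊠ 0≤n)
     ⊞ toWitness {a? = 0ℚ ≤? + 13 / 48} _ ⊠ 0≤n)
    where
    ¼ : ℚ
    ¼ = + 1 / 4
    cube : 0ℚ ≤ ¼ * ¼ * ¼ - ε * ε * ε
    cube = subst (0ℚ ≤_) (≡.sym (factor ε))
      (0≤¼-ε ⊠ (toWitness {a? = 0ℚ ≤? ¼ * ¼} _ ⊞ toWitness {a? = 0ℚ ≤? ¼} _ ⊠ 0≤ε ⊞ 0≤ε ⊠ 0≤ε))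
      where
      factor : ∀ ε → ¼ * ¼ * ¼ - ε * ε * ε ≡ (¼ - ε) * (¼ * ¼ + ¼ * ε + ε * ε)
      factor = solve 1 (λ ε → con (¼ * ¼ * ¼) :- ε :* ε :* ε
        := (con ¼ :- ε) :* (con (¼ * ¼) :+ con ¼ :* ε :+ ε :* ε)) refl
    eq : ∀ n b ε → n - + 4 / 1 * b
       ≡ + 4 / 1 * ((+ 1 / 6 + ε * ε * ε) * n - b) + + 4 / 1 * ((¼ * ¼ * ¼ - ε * ε * ε) * n) + + 13 / 48 * n
    eq = solve 3 (λ n b ε → n :- con (+ 4 / 1) :* b
      := con (+ 4 / 1) :* ((con (+ 1 / 6) :+ ε :* ε :* ε) :* n :- b)
         :+ con (+ 4 / 1) :* ((con (¼ * ¼ * ¼) :- ε :* ε :* ε) :* n) :+ con (+ 13 / 48) :* n) refl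

  -- Since `6b - n ≤ 6ε³n`, the error after division by 108 is at most `48 * 6 ε³n³ = 288 ε³n³`, and
  -- `ε³ ≤ ε` because `ε (1 - ε) (1 + ε)` is nonnegative.
  triangle-density : ∀ (t n b ε : ℚ) → 0ℚ ≤ n → 0ℚ ≤ ε → 0ℚ ≤ 1ℚ - ε →
    0ℚ ≤ (+ 1 / 6 + ε * ε * ε) * n - b →
    0ℚ ≤ + 108 / 1 * t + + 5184 / 1 * (n * n * (+ 6 / 1 * b - n)) - n * n * n →
    (+ 1 / 108 - + 288 / 1 * ε) * (n * n * n) ≤ t
  triangle-density t n b ε 0≤n 0≤ε 0≤1-ε small many = 0≤q-p⇒p≤q (subst (0ℚ ≤_) (≡.sym (eq t n b ε))
    (toWitness {a? = 0ℚ ≤? + 1 / 108} _ ⊠ many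
     ⊞ toWitness {a? = 0ℚ ≤? + 288 / 1} _ ⊠ (0≤n ⊠ 0≤n ⊠ small)
     ⊞ toWitness {a? = 0ℚ ≤? + 288 / 1} _ ⊠
         (0≤ε ⊠ 0≤1-ε ⊠ (toWitness {a? = 0ℚ ≤? 1ℚ} _ ⊞ 0≤ε) ⊠ (0≤n ⊠ 0≤n ⊠ 0≤n))))
    where
    eq : ∀ t n b ε → t - (+ 1 / 108 - + 288 / 1 * ε) * (n * n * n)
      ≡ + 1 / 108 * (+ 108 / 1 * t + + 5184 / 1 * (n * n * (+ 6 / 1 * b - n)) - n * n * n)
        + + 288 / 1 * (n * n * ((+ 1 / 6 + ε * ε * ε) * n - b))
        + + 288 / 1 * (ε * (1ℚ - ε) * (1ℚ + ε) * (n * n * n))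
    eq = solve 4 (λ t n b ε →
      t :- (con (+ 1 / 108) :- con (+ 288 / 1) :* ε) :* (n :* n :* n)
      := con (+ 1 / 108) :* (con (+ 108 / 1) :* t
           :+ con (+ 5184 / 1) :* (n :* n :* (con (+ 6 / 1) :* b :- n)) :- n :* n :* n)
         :+ con (+ 288 / 1) :* (n :* n :* ((con (+ 1 / 6) :+ ε :* ε :* ε) :* n :- b))
         :+ con (+ 288 / 1) :* (ε :* (con 1ℚ :- ε) :* (con 1ℚ :+ ε) :* (n :* n :* n))) refl

open import Data.Rational using (ℚ; _/_; _<_; _≤_; _+_; _-_; _*_; 0ℚ)

theorem3p1 : Σ ℚ λ ε₀ → Σ ℚ λ C → 0ℚ < ε₀ × 0ℚ < C ×
    (∀ (ε : ℚ) → 0ℚ < ε → ε < ε₀ →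
    ∀ (n : ℕ) → 1 ℕ.≤ n → (G : Graph n) →
    n ℕ.* n ℕ.≤ 4 ℕ.* edgeCount G →
    (+ bookNumber G / 1) ≤ (+ 1 / 6 + ε * ε * ε) * (+ n / 1) →
    ¬ IsBalancedCompleteBipartite G →
    (+ 1 / 108 - C * ε) * (+ (n ℕ.* n ℕ.* n) / 1) ≤ (+ triangleCount G / 1))
-- `ε < 1/4` ensures `4b ≤ n` and `ε ≤ 1`; `288 = 5184 * 6 / 108`.
theorem3p1 = + 1 / 4 , + 288 / 1 , toWitness {a? = 0ℚ ℚ.<? + 1 / 4} _ , toWitness {a? = 0ℚ ℚ.<? + 288 / 1} _ , bound
  where
  open Rationals
  bound : ∀ ε → 0ℚ < ε → ε < + 1 / 4 → ∀ n → 1 ℕ.≤ n → (G : Graph n) → n ℕ.* n ℕ.≤ 4 ℕ.* edgeCount G →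
    ι (+ bookNumber G) ≤ (+ 1 / 6 + ε * ε * ε) * ι (+ n) → ¬ IsBalancedCompleteBipartite G →
    (+ 1 / 108 - + 288 / 1 * ε) * ι (+ (n ℕ.* n ℕ.* n)) ≤ ι (+ triangleCount G)
  bound ε 0<ε ε<¼ n 1≤n G n²≤4e book unbalanced =
    subst (λ s → (+ 1 / 108 - + 288 / 1 * ε) * s ≤ ι t) (≡.sym cube)
      (triangle-density (ι t) (ι N) (ι b) ε 0≤n 0≤ε 0≤1-ε small
        (subst (0ℚ ≤_) bound-image (ι-nonneg (IntegerGraph.integer-bound G 1≤n n²≤4e unbalanced 4b≤n))))
    where
    N b t : ℤ
    N = + n
    b = + bookNumber G
    t = + triangleCount G
    0≤n : 0ℚ ≤ ι N
    0≤n = ι-nonneg {N} (ℤ.+≤+ ℕ.z≤n)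
    0≤ε : 0ℚ ≤ ε
    0≤ε = ℚ.<⇒≤ 0<ε
    small : 0ℚ ≤ (+ 1 / 6 + ε * ε * ε) * ι N - ι b
    small = p≤q⇒0≤q-p book
    0≤1-ε : 0ℚ ≤ ℚ.1ℚ - ε
    0≤1-ε = p≤q⇒0≤q-p (ℚ.≤-trans (ℚ.<⇒≤ ε<¼) (toWitness {a? = + 1 / 4 ℚ.≤? ℚ.1ℚ} _))
    cube : ι (+ (n ℕ.* n ℕ.* n)) ≡ ι N * ι N * ι N
    cube = ≡.trans (cong ι (≡.trans (ℤ.pos-* (n ℕ.* n) n) (cong (ℤ._* N) (ℤ.pos-* n n))))
      (≡.trans (ι-* (N ℤ.* N) N) (cong (_* ι N) (ι-* N N)))
    4b≤n : 0ℤ ℤ.≤ N ℤ.- + 4 ℤ.* b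
    4b≤n = ι-nonneg⁻¹ _ (subst (0ℚ ≤_)
      (≡.sym (≡.trans (ι-- N (+ 4 ℤ.* b)) (cong (λ s → ι N - s) (ι-* (+ 4) b))))
      (book-below-quarter (ι N) (ι b) ε 0≤n 0≤ε (p≤q⇒0≤q-p (ℚ.<⇒≤ ε<¼)) small))
    bound-image :
      ι (+ 108 ℤ.* t ℤ.+ + 5184 ℤ.* (N ℤ.* N ℤ.* (+ 6 ℤ.* b ℤ.- N)) ℤ.- N ℤ.* N ℤ.* N)
      ≡ + 108 / 1 * ι t + + 5184 / 1 * (ι N * ι N * (+ 6 / 1 * ι b - ι N)) - ι N * ι N * ι N
    bound-image =
      ≡.trans (ι-- (+ 108 ℤ.* t ℤ.+ + 5184 ℤ.* (N ℤ.* N ℤ.* (+ 6 ℤ.* b ℤ.- N))) (N ℤ.* N ℤ.* N))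
      (cong₂ _-_
        (≡.trans (ι-+ (+ 108 ℤ.* t) (+ 5184 ℤ.* (N ℤ.* N ℤ.* (+ 6 ℤ.* b ℤ.- N))))
          (cong₂ _+_ (ι-* (+ 108) t)
            (≡.trans (ι-* (+ 5184) (N ℤ.* N ℤ.* (+ 6 ℤ.* b ℤ.- N)))
              (cong (λ s → + 5184 / 1 * s)
                (≡.trans (ι-* (N ℤ.* N) (+ 6 ℤ.* b ℤ.- N))
                  (cong₂ _*_ (ι-* N N)
                    (≡.trans (ι-- (+ 6 ℤ.* b) N) (cong (λ s → s - ι N) (ι-* (+ 6) b)))))))))
        (≡.trans (ι-* (N ℤ.* N) N) (cong (_* ι N) (ι-* N N))))
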